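{- Let $n\geq 4$ be an integer, and regard $\tilde{J}(n,2)$ as a subset of the $(n-1)$-dimensional Euclidean space $H_{n,2}=\{(x_1,\dots,x_n)\in\mathbb{R}^n:\sum_i x_i=2\}\simeq\mathbb{R}^{n-1}$. If $n\neq 9$, then $\tilde{J}(n,2)$ is maximal as a two-distance set in $H_{n,2}$. If $n=9$, then the maximal two-distance set in $H_{9,2}$ which contains $\tilde{J}(9,2)$ is (uniquely) $$\left(1^2,0^7\right)^P\ \cup\ \left(\left(\tfrac13\right)^8,\,-\tfrac23\right)^P,$$ which has $45$ vectors.
   Context: Notation: $(a_1^{r_1},\dots,a_t^{r_t})^P$ denotes the set of all vectors obtained by permuting the coordinates of the vector in which $a_i$ occurs $r_i$ times; inside the parentheses exponents are multiplicities, not powers. $\tilde{J}(n,2)=(1^2,0^{n-2})^P\subset\mathbb{R}^n$ is the set of all $0/1$ vectors of length $n$ with exactly two ones (the representation of the Johnson graph $J(n,2)$). A finite subset of a Euclidean space is an $s$-distance set if exactly $s$ distinct values occur as Euclidean distances between distinct points of it. An $s$-distance set is maximal in a given space if no other $s$-distance set in that space contains it. -}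

module Defs where

open import Algebra.Bundles using (CommutativeRing)
open import Data.Fin.Base using (Fin)
open import Data.Fin.Permutation using (Permutation; _⟨$⟩ʳ_)
open import Data.List.Base using (List; []; _∷_; _++_; length; lookup; replicate)
open import Data.Nat.Base using (ℕ; _∸_)
open import Data.Product.Base using (Σ-syntax; ∃-syntax; _×_; _,_)
open import Data.Vec.Functional using (Vector)
import Algebra.Properties.CommutativeMonoid.Sum as Sum
import Data.Vec.Functional.Relation.Binary.Equality.Setoid as VectorEquality
open import Function.Bundles using (_⇔_)
open import Function.Definitions using (Injective)
open import Level using (0ℓ; suc)
open import Relation.Binary.Bundles using (Setoid)
import Relation.Binary.Construct.StrictToNonStrict as NonStrict
open import Relation.Binary.Core using (Rel)
open import Relation.Binary.PropositionalEquality.Core using (_≡_)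
open import Relation.Binary.Structures using (IsStrictTotalOrder)
open import Relation.Nullary.Negation.Core using (¬_)
open import Relation.Unary using (Pred; _∈_; _⊆_; _≐_; _∪_; Satisfiable)

-- The real numbers, given by their (classical, categorical) axioms as a
-- Dedekind-complete ordered field.
record Reals : Set (suc 0ℓ) where
  field
    commutativeRing : CommutativeRing 0ℓ 0ℓ

  open CommutativeRing commutativeRing public

  infix 4 _<_
  infix 8 _⁻¹

  field
    _<_                : Rel Carrier 0ℓ
    isStrictTotalOrder : IsStrictTotalOrder _≈_ _<_
    +-monoˡ-<          : ∀ {x y} z → x < y → x + z < y + z
    *-pos              : ∀ {x y} → 0# < x → 0# < y → 0# < x * y
    0≉1                : ¬ (0# ≈ 1#)
    -- Totalised: nothing is assumed about 0# ⁻¹.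
    _⁻¹                : Carrier → Carrier
    ⁻¹-inverseʳ        : ∀ {x} → ¬ (x ≈ 0#) → x * x ⁻¹ ≈ 1#

  open NonStrict _≈_ _<_ public using (_≤_)

  IsUpperBound : Pred Carrier 0ℓ → Pred Carrier 0ℓ
  IsUpperBound P u = ∀ {x} → x ∈ P → x ≤ u

  IsLeastUpperBound : Pred Carrier 0ℓ → Pred Carrier 0ℓ
  IsLeastUpperBound P s = s ∈ IsUpperBound P × (∀ {u} → u ∈ IsUpperBound P → s ≤ u)

  field
    complete : ∀ (P : Pred Carrier 0ℓ) → Satisfiable P →
               Satisfiable (IsUpperBound P) → Satisfiable (IsLeastUpperBound P)

module Subsets (S : Setoid 0ℓ 0ℓ) where
  open Setoid S

  -- P consists exactly of the values of f; in particular P respects _≈_.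
  EnumeratedBy : Pred Carrier 0ℓ → ∀ {k} → (Fin k → Carrier) → Set
  EnumeratedBy P f = ∀ x → x ∈ P ⇔ (∃[ i ] x ≈ f i)

  -- Repetitions in the enumeration are allowed here, but not in HasSize.
  Finite : Pred Carrier 0ℓ → Set
  Finite P = ∃[ k ] Σ[ f ∈ (Fin k → Carrier) ] EnumeratedBy P f

  HasSize : ℕ → Pred Carrier 0ℓ → Set
  HasSize k P = Σ[ f ∈ (Fin k → Carrier) ] (Injective _≡_ _≈_ f × EnumeratedBy P f)

module Euclidean (ℛ : Reals) where
  open Reals ℛ public renaming (Carrier to ℝ)
  open Sum +-commutativeMonoid public using (sum)
  open VectorEquality setoid public using (_≋_; ≋-setoid)

  Point : ℕ → Set
  Point n = Vector ℝ n

  PointSet : ℕ → Set (suc 0ℓ)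
  PointSet n = Pred (Point n) 0ℓ

  FinitePoints : ∀ {n} → PointSet n → Set
  FinitePoints {n} = Subsets.Finite (≋-setoid n)

  HasPoints : ∀ {n} → ℕ → PointSet n → Set
  HasPoints {n} = Subsets.HasSize (≋-setoid n)

  -- d is the nonnegative square root of Σᵢ (xᵢ - yᵢ)².
  IsDistance : ∀ {n} → Point n → Point n → ℝ → Set
  IsDistance x y d =
    0# ≤ d × d * d ≈ sum (λ i → (x i - y i) * (x i - y i))

  Distances : ∀ {n} → PointSet n → Pred ℝ 0ℓ
  Distances X d =
    ∃[ x ] ∃[ y ] x ∈ X × y ∈ X × ¬ (x ≋ y) × IsDistance x y d

  IsDistanceSet : ∀ {n} → ℕ → PointSet n → Set
  IsDistanceSet s X = FinitePoints X × Subsets.HasSize setoid s (Distances X)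

  IsDistanceSetIn : ∀ {n} → ℕ → PointSet n → PointSet n → Set
  IsDistanceSetIn s E X = X ⊆ E × IsDistanceSet s X

  IsMaximalDistanceSetIn : ∀ {n} → ℕ → PointSet n → PointSet n → Set (suc 0ℓ)
  IsMaximalDistanceSetIn {n} s E X =
    IsDistanceSetIn s E X ×
    (∀ (Y : PointSet n) → IsDistanceSetIn s E Y → X ⊆ Y → Y ≐ X)

  entries : List (ℝ × ℕ) → List ℝ
  entries []             = []
  entries ((a , r) ∷ as) = replicate r a ++ entries as

  -- (a₁^r₁, …, aₜ^rₜ)ᴾ, empty unless r₁ + … + rₜ = n.
  _ᴾ : List (ℝ × ℕ) → ∀ {n} → PointSet n
  (as ᴾ) {n} x =
    Σ[ π ∈ Permutation n (length (entries as)) ]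
      (∀ i → x i ≈ lookup (entries as) (π ⟨$⟩ʳ i))

  2# 3# ⅓ -⅔ : ℝ
  2# = 1# + 1#
  3# = 2# + 1#
  ⅓  = 3# ⁻¹
  -⅔ = - (2# * ⅓)

  -- The hyperplane H_{n,2}.
  H₂ : ∀ n → PointSet n
  H₂ n x = sum x ≈ 2#

  -- The representation of the Johnson graph J(n,2); meant for n ≥ 2.
  J̃₂ : ∀ n → PointSet n
  J̃₂ n = ((1# , 2) ∷ (0# , n ∸ 2) ∷ []) ᴾ

  M₄₅ : PointSet 9
  M₄₅ = (((1# , 2) ∷ (0# , 7) ∷ []) ᴾ) ∪ (((⅓ , 8) ∷ (-⅔ , 1) ∷ []) ᴾ)

{-# OPTIONS --safe #-}
-- Let y lie in a two-distance set containing J̃(n,2) but not in J̃(n,2). The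
-- squared distances are 2 and 4, so |y - eᵢ - eⱼ|² = |y|² + 2 - 2(yᵢ + yⱼ)
-- shows that 2(yᵢ + yⱼ) takes only the values N = |y|² and N - 2 for i ≠ j.
-- Hence coordinates of y differ by 0 or ±1, and y = (c,…,c) + ε eₚ with
-- ε ∈ {0, 1, -1}. Together with nc + ε = 2 and N = 2c + ε(c + ε) this
-- leaves only ε = -1, c = 1/3 and n = 9.
module Submission where

open import Defs
open import Algebra.Bundles using (CommutativeRing)
open import Algebra.Solver.Ring.AlmostCommutativeRing
  using (fromCommutativeRing; _-Raw-AlmostCommutative⟶_)
open import Data.Empty using (⊥; ⊥-elim)
open import Data.Fin.Base as Fin using (Fin; zero; suc; punchIn; punchOut; splitAt; join; _↑ˡ_; _↑ʳ_)
open import Data.Fin.Patterns using (0F; 1F; 2F; 3F)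
open import Data.Fin.Permutation as Perm
  using (Permutation; _⟨$⟩ʳ_; _⟨$⟩ˡ_; insert; insert-punchIn; cast-id)
open import Data.Fin.Properties
  using (_≟_; any?; all?; _<?_; <-cmp; <-asym; <⇒≢; join-splitAt; splitAt-↑ˡ; splitAt-↑ʳ;
         punchIn-punchOut; punchIn-injective; punchInᵢ≢i)
open import Data.Integer.Base as ℤ using (ℤ; +_; -[1+_])
import Data.Integer.Properties as ℤ
open import Data.List.Base
  using (List; []; _∷_; _++_; length; lookup; replicate; filter; cartesianProduct; allFin)
open import Data.List.Membership.Propositional renaming (_∈_ to _∈ˡ_)
open import Data.List.Membership.Propositional.Properties
  using (∈-lookup; ∈-filter⁺; ∈-filter⁻; ∈-cartesianProduct⁺; ∈-allFin)
open import Data.List.Properties using (++-identityʳ; length-replicate)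
import Data.List.Relation.Unary.All as All
open import Data.List.Relation.Unary.AllPairs using (_∷_)
open import Data.List.Relation.Unary.Any using (index)
open import Data.List.Relation.Unary.Any.Properties using (lookup-index)
open import Data.List.Relation.Unary.Unique.Propositional using (Unique)
import Data.List.Relation.Unary.Unique.Propositional.Properties as Unique
import Data.Maybe.Base as Maybe
open import Data.Nat.Base as ℕ using (ℕ; zero; suc; s≤s) renaming (_≤_ to _≤ⁿ_)
open import Data.Product.Base using (_×_; _,_; proj₁; proj₂; ∃-syntax)
open import Data.Sum.Base as Sum using (_⊎_; inj₁; inj₂; [_,_]′)
open import Function.Base using (_∘_; id)
open import Function.Bundles using (mk⇔; Equivalence)
open import Function.Definitions using (Injective)
open import Level using (0ℓ)
open import Relation.Binary.Bundles using (Setoid)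
open import Relation.Binary.Definitions using (tri<; tri≈; tri>)
open import Relation.Binary.PropositionalEquality.Core as ≡ using (_≡_; _≢_)
open import Relation.Binary.Structures using (IsStrictTotalOrder)
open import Relation.Nullary.Decidable.Core using (yes; no; ¬?; _×-dec_; dec⇒maybe)
open import Relation.Nullary.Negation.Core using (¬_)
open import Relation.Unary using (Pred; _∈_; _⊆_; _≐_; _∪_)

-- The hypothesis on a superset `Y` concerns an enumeration of its distances, which are square
-- roots, while the argument runs on squared distances. For n ≥ 4, `J̃₂ n` contains overlapping and
-- disjoint pairs, so √2 and √4 already fill the two places of that enumeration, and every distance
-- in `Y` is one of them. Applying this to two given points of `Y` requires their distance to exist
-- as a real number; completeness supplies it.
--
-- Two coordinates yᵢ and yⱼ are compared through a third one, since yₖ cancels from the difference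
-- of yᵢ + yₖ and yⱼ + yₖ. A single exceptional coordinate remains because two coordinates b + 1
-- together with two coordinates b would produce doubled pair sums 4 apart, whereas the admissible
-- ones are at most 2 apart.
--
-- Membership in `Y` is never decided. All case distinctions on y are finite searches over indices,
-- using the decidable equality that comes with the total order on the reals.

-- A ring solver with integer coefficients

module IntegerSolver {c ℓ} (R : CommutativeRing c ℓ) where
  open CommutativeRing R hiding (zero)
  open import Algebra.Properties.Ring ring using (-‿distribˡ-*; -‿distribʳ-*)
  open import Algebra.Properties.AbelianGroup +-abelianGroup
    using (⁻¹-involutive; ⁻¹-∙-comm; ε⁻¹≈ε)
  open import Algebra.Properties.CommutativeSemigroup +-commutativeSemigroup
    using (interchange)
  open import Algebra.Properties.Semiring.Mult.TCOptimised semiring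
    using (×-homo-+; ×1-homo-*; 1+×) renaming (_×_ to _×′_)
  open import Relation.Binary.Reasoning.Setoid setoid

  -- Integer coefficients have a computing equality test, so numerals are normalised too. With the
  -- optimised multiple, the literals 1, 2 and 3 reduce to `1#`, `2#` and `3#`, and solver
  -- identities apply to these constants directly.
  fromℤ : ℤ → Carrier
  fromℤ (+ n)    = n ×′ 1#
  fromℤ -[1+ n ] = - (suc n ×′ 1#)

  fromℤ-neg : ∀ i → fromℤ (ℤ.- i) ≈ - fromℤ i
  fromℤ-neg (+ zero)  = sym ε⁻¹≈ε
  fromℤ-neg (+ suc n) = refl
  fromℤ-neg -[1+ n ]  = sym (⁻¹-involutive _)

  fromℤ-⊖ : ∀ m n → fromℤ (m ℤ.⊖ n) ≈ m ×′ 1# - n ×′ 1#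
  fromℤ-⊖ zero zero = sym (-‿inverseʳ 0#)
  fromℤ-⊖ zero (suc n) = sym (+-identityˡ _)
  fromℤ-⊖ (suc m) zero = sym (trans (+-congˡ ε⁻¹≈ε) (+-identityʳ _))
  fromℤ-⊖ (suc m) (suc n) = begin
    fromℤ (suc m ℤ.⊖ suc n)                 ≡⟨ ≡.cong fromℤ (ℤ.[1+m]⊖[1+n]≡m⊖n m n) ⟩
    fromℤ (m ℤ.⊖ n)                         ≈⟨ fromℤ-⊖ m n ⟩
    m ×′ 1# - n ×′ 1#                       ≈⟨ +-identityˡ _ ⟨
    0# + (m ×′ 1# - n ×′ 1#)                ≈⟨ +-congʳ (-‿inverseʳ 1#) ⟨
    (1# - 1#) + (m ×′ 1# - n ×′ 1#)         ≈⟨ interchange 1# (- 1#) _ _ ⟩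
    (1# + m ×′ 1#) + (- 1# - n ×′ 1#)       ≈⟨ +-congˡ (⁻¹-∙-comm 1# _) ⟩
    (1# + m ×′ 1#) - (1# + n ×′ 1#)         ≈⟨ +-cong (1+× m 1#) (-‿cong (1+× n 1#)) ⟨
    suc m ×′ 1# - suc n ×′ 1#               ∎

  fromℤ-+ : ∀ i j → fromℤ (i ℤ.+ j) ≈ fromℤ i + fromℤ j
  fromℤ-+ (+ m)    (+ n)    = ×-homo-+ 1# m n
  fromℤ-+ (+ m)    -[1+ n ] = fromℤ-⊖ m (suc n)
  fromℤ-+ -[1+ m ] (+ n)    = trans (fromℤ-⊖ n (suc m)) (+-comm _ _)
  fromℤ-+ -[1+ m ] -[1+ n ] = begin
    fromℤ (-[1+ m ] ℤ.+ -[1+ n ])           ≡⟨ ≡.cong fromℤ (ℤ.neg-distrib-+ (+ suc m) (+ suc n)) ⟨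
    fromℤ (ℤ.- (+ suc m ℤ.+ + suc n))       ≈⟨ fromℤ-neg (+ suc m ℤ.+ + suc n) ⟩
    - fromℤ (+ suc m ℤ.+ + suc n)           ≈⟨ -‿cong (×-homo-+ 1# (suc m) (suc n)) ⟩
    - (suc m ×′ 1# + suc n ×′ 1#)           ≈⟨ ⁻¹-∙-comm _ _ ⟨
    - (suc m ×′ 1#) - suc n ×′ 1#           ∎

  fromℤ-*⁺ : ∀ m n → fromℤ (+ m ℤ.* + n) ≈ m ×′ 1# * n ×′ 1#
  fromℤ-*⁺ m n = trans (reflexive (≡.cong fromℤ (≡.sym (ℤ.pos-* m n)))) (×1-homo-* m n)

  fromℤ-*ʳ : ∀ m j → fromℤ (+ m ℤ.* j) ≈ m ×′ 1# * fromℤ j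
  fromℤ-*ʳ m (+ n)    = fromℤ-*⁺ m n
  fromℤ-*ʳ m -[1+ n ] = begin
    fromℤ (+ m ℤ.* -[1+ n ])        ≡⟨ ≡.cong fromℤ (ℤ.neg-distribʳ-* (+ m) (+ suc n)) ⟨
    fromℤ (ℤ.- (+ m ℤ.* + suc n))   ≈⟨ fromℤ-neg (+ m ℤ.* + suc n) ⟩
    - fromℤ (+ m ℤ.* + suc n)       ≈⟨ -‿cong (fromℤ-*⁺ m (suc n)) ⟩
    - (m ×′ 1# * suc n ×′ 1#)       ≈⟨ -‿distribʳ-* _ _ ⟩
    m ×′ 1# * - (suc n ×′ 1#)       ∎

  fromℤ-* : ∀ i j → fromℤ (i ℤ.* j) ≈ fromℤ i * fromℤ j
  fromℤ-* (+ m)    j = fromℤ-*ʳ m j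
  fromℤ-* -[1+ m ] j = begin
    fromℤ (-[1+ m ] ℤ.* j)          ≡⟨ ≡.cong fromℤ (ℤ.neg-distribˡ-* (+ suc m) j) ⟨
    fromℤ (ℤ.- (+ suc m ℤ.* j))     ≈⟨ fromℤ-neg (+ suc m ℤ.* j) ⟩
    - fromℤ (+ suc m ℤ.* j)         ≈⟨ -‿cong (fromℤ-*ʳ (suc m) j) ⟩
    - (suc m ×′ 1# * fromℤ j)       ≈⟨ -‿distribˡ-* _ _ ⟩
    - (suc m ×′ 1#) * fromℤ j       ∎

  homomorphism : ℤ.+-*-rawRing -Raw-AlmostCommutative⟶ fromCommutativeRing R
  homomorphism = record
    { ⟦_⟧    = fromℤ
    ; +-homo = fromℤ-+
    ; *-homo = fromℤ-*
    ; -‿homo = fromℤ-neg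
    ; 0-homo = refl
    ; 1-homo = refl
    }

  open import Algebra.Solver.Ring ℤ.+-*-rawRing (fromCommutativeRing R) homomorphism
    (λ i j → Maybe.map (λ i≡j → reflexive (≡.cong fromℤ i≡j)) (dec⇒maybe (i ℤ.≟ j))) public

-- Consequences of the ordered field axioms

module OrderedField (ℛ : Reals) where
  open Euclidean ℛ hiding (zero)
  open IsStrictTotalOrder isStrictTotalOrder public
    using (compare; irrefl; <-respʳ-≈; <-respˡ-≈)
    renaming (trans to <-trans; _≟_ to _≟ʳ_)
  open import Algebra.Properties.Semiring.Mult.TCOptimised semiring public
    using (1+×) renaming (_×_ to _×′_)
  open IntegerSolver commutativeRing public using (solve; _:=_; con; _:+_; _:*_; _:-_; :-_)

  -- A certificate format: the multiplier k is found by hand, the identity x - y = k (p - q) is left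
  -- to the ring solver, and the hypothesis p = q enters once. The variants below take linear
  -- combinations of several hypotheses; a contradiction is the case in which x - y is a nonzero
  -- constant or a positive quantity.
  combine : ∀ {x y p q} k → x - y ≈ k * (p - q) → p ≈ q → x ≈ y
  combine {x} {y} {p} {q} k eq p≈q = begin
    x                  ≈⟨ solve 2 (λ x y → x := (x :- y) :+ y) refl x y ⟩
    (x - y) + y        ≈⟨ +-congʳ (trans eq (*-congˡ (+-congʳ p≈q))) ⟩
    k * (q - q) + y    ≈⟨ solve 3 (λ k q y → k :* (q :- q) :+ y := y) refl k q y ⟩
    y                  ∎
    where open import Relation.Binary.Reasoning.Setoid setoid

  combine₂ : ∀ {x y p q r s} k l → x - y ≈ k * (p - q) + l * (r - s) → p ≈ q → r ≈ s → x ≈ y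
  combine₂ {p = p} {q} {r} {s} k l eq p≈q r≈s = combine k (begin
    _                              ≈⟨ eq ⟩
    k * (p - q) + l * (r - s)      ≈⟨ +-congˡ (*-congˡ (+-congʳ r≈s)) ⟩
    k * (p - q) + l * (s - s)      ≈⟨ solve 4 (λ k l d s → k :* d :+ l :* (s :- s) := k :* d) refl
                                      k l (p - q) s ⟩
    k * (p - q)                    ∎) p≈q
    where open import Relation.Binary.Reasoning.Setoid setoid

  combine₃ : ∀ {x y p q r s t u} k l m → x - y ≈ k * (p - q) + l * (r - s) + m * (t - u) →
             p ≈ q → r ≈ s → t ≈ u → x ≈ y
  combine₃ {p = p} {q} {r} {s} {t} {u} k l m eq p≈q r≈s t≈u = combine₂ k l (begin
    _                                            ≈⟨ eq ⟩
    k * (p - q) + l * (r - s) + m * (t - u)      ≈⟨ +-congˡ (*-congˡ (+-congʳ t≈u)) ⟩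
    k * (p - q) + l * (r - s) + m * (u - u)      ≈⟨ solve 3 (λ e m u → e :+ m :* (u :- u) := e) refl
                                                     (k * (p - q) + l * (r - s)) m u ⟩
    k * (p - q) + l * (r - s)                    ∎) p≈q r≈s
    where open import Relation.Binary.Reasoning.Setoid setoid

  <⇒≉ : ∀ {x y} → x < y → ¬ (x ≈ y)
  <⇒≉ x<y x≈y = irrefl x≈y x<y

  <⇒≱ : ∀ {x y} → x < y → ¬ (y ≤ x)
  <⇒≱ x<y (inj₁ y<x) = irrefl refl (<-trans x<y y<x)
  <⇒≱ x<y (inj₂ y≈x) = irrefl (sym y≈x) x<y

  ≤-respʳ : ∀ {x y z} → y ≈ z → x ≤ y → x ≤ z
  ≤-respʳ y≈z (inj₁ x<y) = inj₁ (<-respʳ-≈ y≈z x<y)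
  ≤-respʳ y≈z (inj₂ x≈y) = inj₂ (trans x≈y y≈z)

  ≉⇒< : ∀ {x y} → x ≤ y → ¬ (x ≈ y) → x < y
  ≉⇒< (inj₁ x<y) x≉y = x<y
  ≉⇒< (inj₂ x≈y) x≉y = ⊥-elim (x≉y x≈y)

  ≮≯⇒≈ : ∀ {x y} → ¬ (x < y) → ¬ (y < x) → x ≈ y
  ≮≯⇒≈ {x} {y} x≮y y≮x with compare x y
  ... | tri< x<y _ _ = ⊥-elim (x≮y x<y)
  ... | tri≈ _ x≈y _ = x≈y
  ... | tri> _ _ y<x = ⊥-elim (y≮x y<x)

  ≮⇒≥ : ∀ {x y} → ¬ (x < y) → y ≤ x
  ≮⇒≥ {x} {y} x≮y with compare x y
  ... | tri< x<y _ _ = ⊥-elim (x≮y x<y)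
  ... | tri≈ _ x≈y _ = inj₂ (sym x≈y)
  ... | tri> _ _ y<x = inj₁ y<x

  ≤-respˡ : ∀ {x y z} → x ≈ y → y ≤ z → x ≤ z
  ≤-respˡ x≈y (inj₁ y<z) = inj₁ (<-respˡ-≈ (sym x≈y) y<z)
  ≤-respˡ x≈y (inj₂ y≈z) = inj₂ (trans x≈y y≈z)

  ≤-<-trans : ∀ {x y z} → x ≤ y → y < z → x < z
  ≤-<-trans (inj₁ x<y) y<z = <-trans x<y y<z
  ≤-<-trans (inj₂ x≈y) y<z = <-respˡ-≈ (sym x≈y) y<z

  <-by : ∀ {x y d} → 0# < d → y - x ≈ d → x < y
  <-by {x} {y} {d} 0<d eq = <-respˡ-≈ (+-identityˡ x) (<-respʳ-≈ d+x≈y (+-monoˡ-< x 0<d))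
    where
    d+x≈y : d + x ≈ y
    d+x≈y = trans (+-congʳ (sym eq)) (solve 2 (λ x y → (y :- x) :+ x := y) refl x y)

  0<- : ∀ {x y} → x < y → 0# < y - x
  0<- {x} x<y = <-respˡ-≈ (-‿inverseʳ x) (+-monoˡ-< (- x) x<y)

  +-pos : ∀ {x y} → 0# ≤ x → 0# < y → 0# < x + y
  +-pos {x} {y} 0≤x 0<y =
    ≤-<-trans 0≤x (<-by 0<y (solve 2 (λ x y → (x :+ y) :- x := y) refl x y))

  +-nonneg : ∀ {x y} → 0# ≤ x → 0# ≤ y → 0# ≤ x + y
  +-nonneg 0≤x        (inj₁ 0<y) = inj₁ (+-pos 0≤x 0<y)
  +-nonneg (inj₁ 0<x) (inj₂ 0≈y) =
    inj₁ (<-respʳ-≈ (trans (sym (+-identityʳ _)) (+-congˡ 0≈y)) 0<x)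
  +-nonneg (inj₂ 0≈x) (inj₂ 0≈y) = inj₂ (trans (sym (+-identityˡ 0#)) (+-cong 0≈x 0≈y))

  square-nonneg : ∀ x → 0# ≤ x * x
  square-nonneg x with compare 0# x
  ... | tri< 0<x _ _ = inj₁ (*-pos 0<x 0<x)
  ... | tri≈ _ 0≈x _ = inj₂ (sym (trans (*-congʳ (sym 0≈x)) (zeroˡ x)))
  ... | tri> _ _ x<0 = inj₁ (<-respʳ-≈
    (solve 1 (λ x → (con (+ 0) :- x) :* (con (+ 0) :- x) := x :* x) refl x)
    (*-pos (0<- x<0) (0<- x<0)))

  0<1 : 0# < 1#
  0<1 with square-nonneg 1#
  ... | inj₁ 0<1*1 = <-respʳ-≈ (*-identityˡ 1#) 0<1*1
  ... | inj₂ 0≈1*1 = ⊥-elim (0≉1 (trans 0≈1*1 (*-identityˡ 1#)))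

  0≤×1 : ∀ n → 0# ≤ n ×′ 1#
  0<×1 : ∀ n → 0# < suc n ×′ 1#
  0≤×1 zero    = inj₂ refl
  0≤×1 (suc n) = inj₁ (0<×1 n)
  0<×1 n = <-respʳ-≈ (trans (+-comm _ _) (sym (1+× n 1#))) (+-pos (0≤×1 n) 0<1)

  suc×1≉0 : ∀ n → ¬ (suc n ×′ 1# ≈ 0#)
  suc×1≉0 n eq = <⇒≉ (0<×1 n) (sym eq)

  -- Characteristic zero. This turns a real equation for the dimension into an equation of natural
  -- numbers.
  ×1-injective : ∀ m n → m ×′ 1# ≈ n ×′ 1# → m ≡ n
  ×1-injective zero    zero    eq = ≡.refl
  ×1-injective zero    (suc n) eq = ⊥-elim (suc×1≉0 n (sym eq))
  ×1-injective (suc m) zero    eq = ⊥-elim (suc×1≉0 m eq)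
  ×1-injective (suc m) (suc n) eq = ≡.cong suc (×1-injective m n
    (combine 1# (solve 2 (λ x y → x :- y := con (+ 1) :* ((con (+ 1) :+ x) :- (con (+ 1) :+ y)))
      refl _ _)
      (trans (sym (1+× m 1#)) (trans eq (1+× n 1#)))))

  *-cancelˡ : ∀ {x y z} → ¬ (x ≈ 0#) → x * y ≈ x * z → y ≈ z
  *-cancelˡ {x} {y} {z} x≉0 xy≈xz = combine₂ (x ⁻¹) (z - y)
    (solve 4 (λ x w y z → y :- z := w :* (x :* y :- x :* z) :+ (z :- y) :* (x :* w :- con (+ 1))) refl
      x (x ⁻¹) y z)
    xy≈xz (⁻¹-inverseʳ x≉0)

  ⁻¹-pos : ∀ {x} → 0# < x → 0# < x ⁻¹
  ⁻¹-pos {x} 0<x with compare 0# (x ⁻¹)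
  ... | tri< 0<y _ _ = 0<y
  ... | tri≈ _ 0≈y _ = ⊥-elim (0≉1 (trans (sym (zeroʳ x)) (trans (*-congˡ 0≈y) xx⁻¹≈1)))
    where xx⁻¹≈1 = ⁻¹-inverseʳ (λ x≈0 → <⇒≉ 0<x (sym x≈0))
  ... | tri> _ _ y<0 = ⊥-elim (<⇒≉ (+-pos (inj₁ (*-pos 0<x (0<- y<0))) 0<1)
    (combine (- 1#) (solve 2 (λ x y → con (+ 0) :- (x :* (con (+ 0) :- y) :+ con (+ 1))
                                  := (:- con (+ 1)) :* (con (+ 1) :- x :* y)) refl
      x (x ⁻¹)) (sym xx⁻¹≈1)))
    where xx⁻¹≈1 = ⁻¹-inverseʳ (λ x≈0 → <⇒≉ 0<x (sym x≈0))

  square-mono-< : ∀ {x y} → 0# ≤ x → x < y → x * x < y * y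
  square-mono-< {x} {y} 0≤x x<y = <-by
    (*-pos (0<- x<y) (+-pos 0≤x (≤-<-trans 0≤x x<y)))
    (solve 2 (λ x y → y :* y :- x :* x := (y :- x) :* (x :+ y)) refl x y)

  square-injective : ∀ {x y} → 0# ≤ x → 0# ≤ y → x * x ≈ y * y → x ≈ y
  square-injective {x} {y} 0≤x 0≤y eq with compare x y
  ... | tri< x<y _ _ = ⊥-elim (<⇒≉ (square-mono-< 0≤x x<y) eq)
  ... | tri≈ _ x≈y _ = x≈y
  ... | tri> _ _ y<x = ⊥-elim (<⇒≉ (square-mono-< 0≤y y<x) (sym eq))

  -- Square roots from completeness

  module SquareRoot (a : ℝ) (0≤a : 0# ≤ a) where
    Below : ℝ → Set
    Below x = x * x ≤ a

    lub : ∃[ s ] IsLeastUpperBound Below s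
    -- The bound a + 1 works for small and large a alike, since (a + 1)² - a = a² + a + 1 > 0. The
    -- witness 0 for nonemptiness also makes the supremum nonnegative.
    lub = complete Below (0# , ≤-respˡ (zeroˡ 0#) 0≤a) (a + 1# , bound)
      where
      bound : IsUpperBound Below (a + 1#)
      bound {x} xx≤a = ≮⇒≥ λ a+1<x → <⇒≱
        (<-trans
          (<-by (+-pos (+-nonneg (square-nonneg a) 0≤a) 0<1)
            (solve 1 (λ a → (a :+ con (+ 1)) :* (a :+ con (+ 1)) :- a
                       := (a :* a :+ a) :+ con (+ 1)) refl a))
          (square-mono-< (inj₁ (+-pos 0≤a 0<1)) a+1<x))
        xx≤a

    root : ℝ
    root = proj₁ lub

    root-nonneg : 0# ≤ root
    root-nonneg = proj₁ (proj₂ lub) (≤-respˡ (zeroˡ 0#) 0≤a)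

    -- For ε = (a - s²)/(2s + 1 + (a - s²)), s + ε is still in Below.
    root-not-small : ¬ (root * root < a)
    root-not-small ss<a = <⇒≱ (<-by 0<ε (solve 2 (λ s e → (s :+ e) :- s := e) refl s ε))
                              (proj₁ (proj₂ lub) (inj₁ s+ε-below))
      where
      s = root
      δ = a - s * s
      q = (s + s) + 1# + δ
      0<δ : 0# < δ
      0<δ = 0<- ss<a
      0<2s+1 : 0# < (s + s) + 1#
      0<2s+1 = +-pos (+-nonneg root-nonneg root-nonneg) 0<1
      0<q : 0# < q
      0<q = +-pos (inj₁ 0<2s+1) 0<δ
      w = q ⁻¹
      0<w : 0# < w
      0<w = ⁻¹-pos 0<q
      qw≈1 : q * w ≈ 1#
      qw≈1 = ⁻¹-inverseʳ (λ q≈0 → <⇒≉ 0<q (sym q≈0))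
      ε = δ * w
      0<ε : 0# < ε
      0<ε = *-pos 0<δ 0<w
      -- Since q w = 1, a - (s + ε)² = ε q - ε (2s + ε) = ε (δ + 1 - ε) = ε (δ + w (2s + 1)).
      s+ε-below : (s + ε) * (s + ε) < a
      s+ε-below = <-by (*-pos 0<ε (+-pos (inj₁ 0<δ) (*-pos 0<w 0<2s+1)))
        (combine (- (δ + ε))
          (solve 3 (λ s a w → let δ = a :- s :* s
                                  t = (s :+ s) :+ con (+ 1)
                                  ε = δ :* w in
             (a :- (s :+ ε) :* (s :+ ε)) :- ε :* (δ :+ w :* t)
             := (:- (δ :+ ε)) :* ((t :+ δ) :* w :- con (+ 1))) refl s a w)
          qw≈1)

    -- For ε = (s² - a)/2s, s - ε is still an upper bound, as (s - ε)² = a + ε².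
    root-not-large : ¬ (a < root * root)
    root-not-large a<ss = <⇒≱ (<-by 0<ε (solve 2 (λ s e → s :- (s :- e) := e) refl s ε))
                              (proj₂ (proj₂ lub) s-ε-bound)
      where
      s = root
      0<s : 0# < s
      0<s = ≉⇒< root-nonneg λ 0≈s →
        <⇒≱ a<ss (≤-respˡ {s * s} {0#} {a} (trans (*-congʳ (sym 0≈s)) (zeroˡ s)) 0≤a)
      0<s+s : 0# < s + s
      0<s+s = +-pos (inj₁ 0<s) 0<s
      w = (s + s) ⁻¹
      0<w : 0# < w
      0<w = ⁻¹-pos 0<s+s
      2sw≈1 : (s + s) * w ≈ 1#
      2sw≈1 = ⁻¹-inverseʳ (λ 2s≈0 → <⇒≉ 0<s+s (sym 2s≈0))
      ε = (s * s - a) * w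
      0<ε : 0# < ε
      0<ε = *-pos (0<- a<ss) 0<w
      -- s - ε = (a + s²)/2s is the Newton iterate. Its sign matters because squaring is monotone
      -- only on nonnegative numbers.
      s-ε-pos : 0# < s - ε
      s-ε-pos = <-respʳ-≈
        (combine {p = 1#} {q = (s + s) * w} (- s)
          (solve 3 (λ s a w → w :* (a :+ s :* s) :- (s :- (s :* s :- a) :* w)
                               := (:- s) :* (con (+ 1) :- (s :+ s) :* w)) refl s a w)
          (sym 2sw≈1))
        (*-pos 0<w (+-pos 0≤a (*-pos 0<s 0<s)))
      a<[s-ε]² : a < (s - ε) * (s - ε)
      a<[s-ε]² = <-by (*-pos 0<ε 0<ε)
        (combine {p = (s + s) * w} {q = 1#} (- (s * s - a))
          (solve 3 (λ s a w → let ε = (s :* s :- a) :* w in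
             ((s :- ε) :* (s :- ε) :- a) :- ε :* ε
             := (:- (s :* s :- a)) :* ((s :+ s) :* w :- con (+ 1))) refl s a w)
          2sw≈1)
      s-ε-bound : IsUpperBound Below (s - ε)
      s-ε-bound {x} xx≤a = ≮⇒≥ λ s-ε<x → <⇒≱
        (<-trans a<[s-ε]² (square-mono-< (inj₁ s-ε-pos) s-ε<x)) xx≤a

    root-square : root * root ≈ a
    root-square = ≮≯⇒≈ root-not-small root-not-large

  -- Abstract, because the normal form of the root contains all these proofs.
  abstract
    sqrt : ∀ {a} → 0# ≤ a → ∃[ d ] (0# ≤ d × d * d ≈ a)
    sqrt 0≤a = root , root-nonneg , root-square where open SquareRoot _ 0≤a

-- Pairs of distinct indices

lookup-injective : ∀ {A : Set} {xs : List A} → Unique xs →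
                   Injective _≡_ _≡_ (lookup xs)
lookup-injective (_ ∷ _) {zero} {zero} _ = ≡.refl
lookup-injective (x∉xs ∷ _) {zero} {suc j} eq = ⊥-elim (All.lookup x∉xs (∈-lookup j) eq)
lookup-injective (x∉xs ∷ _) {suc i} {zero} eq = ⊥-elim (All.lookup x∉xs (∈-lookup i) (≡.sym eq))
lookup-injective (_ ∷ xs!) {suc i} {suc j} eq = ≡.cong suc (lookup-injective xs! eq)

-- Taking the representative i < j of each unordered pair keeps the enumeration free of repetitions,
-- as `HasSize` demands.
increasingPairs : ∀ n → List (Fin n × Fin n)
increasingPairs n = filter (λ (i , j) → i <? j) (cartesianProduct (allFin n) (allFin n))

increasingPairs-unique : ∀ n → Unique (increasingPairs n)
increasingPairs-unique n = Unique.filter⁺ (λ (i , j) → i <? j)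
  (Unique.cartesianProduct⁺ (Unique.allFin⁺ n) (Unique.allFin⁺ n))

∈-increasingPairs⁺ : ∀ {n} {i j : Fin n} → i Fin.< j → (i , j) ∈ˡ increasingPairs n
∈-increasingPairs⁺ {i = i} {j} =
  ∈-filter⁺ (λ (i , j) → i <? j) (∈-cartesianProduct⁺ (∈-allFin i) (∈-allFin j))

∈-increasingPairs⁻ : ∀ {n} {i j : Fin n} → (i , j) ∈ˡ increasingPairs n → i Fin.< j
∈-increasingPairs⁻ {n} =
  proj₂ ∘ ∈-filter⁻ (λ (i , j) → i <? j) {xs = cartesianProduct (allFin n) (allFin n)}

-- Supplies the common partner through which two coordinates are compared. The indices may coincide,
-- so it also yields an index different from a single given one.
third-index : ∀ {m} (i j : Fin (3 ℕ.+ m)) → ∃[ k ] (k ≢ i × k ≢ j)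
third-index zero          zero          = suc zero , (λ ()) , (λ ())
third-index zero          (suc zero)    = suc (suc zero) , (λ ()) , (λ ())
third-index zero          (suc (suc _)) = suc zero , (λ ()) , (λ ())
third-index (suc zero)    zero          = suc (suc zero) , (λ ()) , (λ ())
third-index (suc (suc _)) zero          = suc zero , (λ ()) , (λ ())
third-index (suc _)       (suc _)       = zero , (λ ()) , (λ ())

-- Permutations with prescribed values

insert-self : ∀ {m n} i j (π : Permutation m n) → insert i j π ⟨$⟩ʳ i ≡ j
insert-self i j π with i ≟ i
... | yes _  = ≡.refl
... | no i≢i = ⊥-elim (i≢i ≡.refl)

-- The case distinction that matches `insert`: a permutation built by inserting at i is known at i
-- and at each `punchIn i k`.
punchIn-elim : ∀ {n ℓ} (P : Pred (Fin (suc n)) ℓ) i → P i → (∀ k → P (punchIn i k)) → ∀ k → P k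
punchIn-elim P i pi pin k with i ≟ k
... | yes ≡.refl = pi
... | no i≢k     = ≡.subst P (punchIn-punchOut i≢k) (pin (punchOut i≢k))

-- Enumerations of unions

module _ {S : Setoid 0ℓ 0ℓ} where
  open Setoid S
  open Subsets S

  HasSize⇒Finite : ∀ {k P} → HasSize k P → Finite P
  HasSize⇒Finite (f , _ , enum) = _ , f , enum

  HasSize-∪ : ∀ {k l P Q} → HasSize k P → HasSize l Q → (∀ {x y} → x ∈ P → y ∈ Q → ¬ (x ≈ y)) →
              HasSize (k ℕ.+ l) (P ∪ Q)
  HasSize-∪ {k} {l} {P} {Q} (f , f-inj , f-enum) (g , g-inj , g-enum) disjoint =
    h ∘ splitAt k , inj , λ x → mk⇔ to (from x)
    where
    h : Fin k ⊎ Fin l → Carrier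
    h = [ f , g ]′

    f∈P : ∀ i → f i ∈ P
    f∈P i = Equivalence.from (f-enum _) (i , refl)

    g∈Q : ∀ j → g j ∈ Q
    g∈Q j = Equivalence.from (g-enum _) (j , refl)

    h-inj : ∀ s t → h s ≈ h t → s ≡ t
    h-inj (inj₁ i) (inj₁ j) eq = ≡.cong inj₁ (f-inj eq)
    h-inj (inj₁ i) (inj₂ j) eq = ⊥-elim (disjoint (f∈P i) (g∈Q j) eq)
    h-inj (inj₂ i) (inj₁ j) eq = ⊥-elim (disjoint (f∈P j) (g∈Q i) (sym eq))
    h-inj (inj₂ i) (inj₂ j) eq = ≡.cong inj₂ (g-inj eq)

    inj : Injective _≡_ _≈_ (h ∘ splitAt k)
    inj {i} {j} eq = ≡.trans (≡.sym (join-splitAt k l i))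
      (≡.trans (≡.cong (join k l) (h-inj (splitAt k i) (splitAt k j) eq)) (join-splitAt k l j))

    to : ∀ {x} → x ∈ P ∪ Q → ∃[ i ] x ≈ h (splitAt k i)
    to (inj₁ x∈P) with i , eq ← Equivalence.to (f-enum _) x∈P =
      i ↑ˡ l , trans eq (reflexive (≡.sym (≡.cong h (splitAt-↑ˡ k i l))))
    to (inj₂ x∈Q) with j , eq ← Equivalence.to (g-enum _) x∈Q =
      k ↑ʳ j , trans eq (reflexive (≡.sym (≡.cong h (splitAt-↑ʳ k l j))))

    from : ∀ x → ∃[ i ] x ≈ h (splitAt k i) → x ∈ P ∪ Q
    from x (i , eq) with splitAt k i
    ... | inj₁ i′ = inj₁ (Equivalence.from (f-enum x) (i′ , eq))
    ... | inj₂ j′ = inj₂ (Equivalence.from (g-enum x) (j′ , eq))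

module Geometry (ℛ : Reals) where
  open Euclidean ℛ hiding (zero)
  open OrderedField ℛ
  open import Algebra.Properties.CommutativeMonoid.Sum +-commutativeMonoid using (sum-cong-≋)
  open import Relation.Binary.Reasoning.Setoid setoid

  -- Inner products and squared distances

  ⟪_,_⟫ : ∀ {n} → Point n → Point n → ℝ
  ⟪ x , y ⟫ = sum (λ i → x i * y i)

  dist² : ∀ {n} → Point n → Point n → ℝ
  dist² x y = sum (λ i → (x i - y i) * (x i - y i))

  ⟪⟫-cong : ∀ {n} {x x′ y y′ : Point n} → x ≋ x′ → y ≋ y′ → ⟪ x , y ⟫ ≈ ⟪ x′ , y′ ⟫
  ⟪⟫-cong x≋x′ y≋y′ = sum-cong-≋ (λ i → *-cong (x≋x′ i) (y≋y′ i))

  dist²-cong : ∀ {n} {x x′ y y′ : Point n} → x ≋ x′ → y ≋ y′ → dist² x y ≈ dist² x′ y′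
  dist²-cong x≋x′ y≋y′ = sum-cong-≋ (λ i → *-cong (d i) (d i))
    where d = λ i → +-cong (x≋x′ i) (-‿cong (y≋y′ i))

  dist²-sym : ∀ {n} (x y : Point n) → dist² x y ≈ dist² y x
  dist²-sym x y = sum-cong-≋ (λ i →
    solve 2 (λ a b → (a :- b) :* (a :- b) := (b :- a) :* (b :- a)) refl (x i) (y i))

  dist²-nonneg : ∀ {n} (x y : Point n) → 0# ≤ dist² x y
  dist²-nonneg {zero}  x y = inj₂ refl
  dist²-nonneg {suc n} x y = +-nonneg (square-nonneg _) (dist²-nonneg (x ∘ suc) (y ∘ suc))

  dist²-self : ∀ {n} (x : Point n) → dist² x x ≈ 0#
  dist²-self {zero}  x = refl
  dist²-self {suc n} x = trans (+-congˡ (dist²-self (x ∘ suc)))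
    (solve 1 (λ a → (a :- a) :* (a :- a) :+ con (+ 0) := con (+ 0)) refl (x zero))

  dist²-polar : ∀ {n} (x y : Point n) → dist² x y ≈ ⟪ x , x ⟫ + ⟪ y , y ⟫ - 2# * ⟪ x , y ⟫
  dist²-polar {zero}  x y =
    solve 0 (con (+ 0) := con (+ 0) :+ con (+ 0) :- con (+ 2) :* con (+ 0)) refl
  dist²-polar {suc n} x y = trans (+-congˡ (dist²-polar (x ∘ suc) (y ∘ suc)))
    (solve 5 (λ a b p q r → (a :- b) :* (a :- b) :+ (p :+ q :- con (+ 2) :* r)
                         := (a :* a :+ p) :+ (b :* b :+ q) :- con (+ 2) :* (a :* b :+ r))
      refl (x zero) (y zero) ⟪ x ∘ suc , x ∘ suc ⟫ ⟪ y ∘ suc , y ∘ suc ⟫ ⟪ x ∘ suc , y ∘ suc ⟫)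

  ⟪⟫-+ : ∀ {n} (y x z : Point n) → ⟪ y , (λ i → x i + z i) ⟫ ≈ ⟪ y , x ⟫ + ⟪ y , z ⟫
  ⟪⟫-+ {zero}  y x z = sym (+-identityˡ 0#)
  ⟪⟫-+ {suc n} y x z = trans (+-congˡ (⟪⟫-+ (y ∘ suc) (x ∘ suc) (z ∘ suc)))
    (solve 5 (λ a b c p q → a :* (b :+ c) :+ (p :+ q) := (a :* b :+ p) :+ (a :* c :+ q))
      refl (y zero) (x zero) (z zero) ⟪ y ∘ suc , x ∘ suc ⟫ ⟪ y ∘ suc , z ∘ suc ⟫)

  ⟪⟫-shift : ∀ {n} c ε (y x : Point n) → ⟪ y , (λ i → c + ε * x i) ⟫ ≈ c * sum y + ε * ⟪ y , x ⟫
  ⟪⟫-shift {zero}  c ε y x =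
    solve 2 (λ c e → con (+ 0) := c :* con (+ 0) :+ e :* con (+ 0)) refl c ε
  ⟪⟫-shift {suc n} c ε y x = trans (+-congˡ (⟪⟫-shift c ε (y ∘ suc) (x ∘ suc)))
    (solve 6 (λ c e a b s p → a :* (c :+ e :* b) :+ (c :* s :+ e :* p)
                           := c :* (a :+ s) :+ e :* (a :* b :+ p))
      refl c ε (y zero) (x zero) (sum (y ∘ suc)) ⟪ y ∘ suc , x ∘ suc ⟫)

  sum-shift : ∀ {n} c ε (x : Point n) → sum (λ i → c + ε * x i) ≈ n ×′ 1# * c + ε * sum x
  sum-shift {zero}  c ε x = solve 2 (λ c e → con (+ 0) := con (+ 0) :* c :+ e :* con (+ 0)) refl c ε
  sum-shift {suc n} c ε x = begin
    (c + ε * x zero) + sum (λ i → c + ε * x (suc i))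
      ≈⟨ +-congˡ (sum-shift c ε (x ∘ suc)) ⟩
    (c + ε * x zero) + (n ×′ 1# * c + ε * sum (x ∘ suc))
      ≈⟨ solve 5 (λ c e a ν s → (c :+ e :* a) :+ (ν :* c :+ e :* s)
                             := (con (+ 1) :+ ν) :* c :+ e :* (a :+ s))
           refl c ε (x zero) (n ×′ 1#) (sum (x ∘ suc)) ⟩
    (1# + n ×′ 1#) * c + ε * sum x
      ≈⟨ +-congʳ (*-congʳ (1+× n 1#)) ⟨
    suc n ×′ 1# * c + ε * sum x ∎

  -- The standard basis vector eᵢ. Recursion on both indices, in place of a decision of equality,
  -- lets sums against it be evaluated by structural induction.
  δ : ∀ {n} → Fin n → Point n
  δ zero    zero    = 1#
  δ zero    (suc _) = 0#
  δ (suc _) zero    = 0#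
  δ (suc i) (suc j) = δ i j

  δ-same : ∀ {n} (i : Fin n) → δ i i ≡ 1#
  δ-same zero    = ≡.refl
  δ-same (suc i) = δ-same i

  δ-diff : ∀ {n} {i j : Fin n} → i ≢ j → δ i j ≡ 0#
  δ-diff {i = zero}  {zero}  i≢j = ⊥-elim (i≢j ≡.refl)
  δ-diff {i = zero}  {suc j} i≢j = ≡.refl
  δ-diff {i = suc i} {zero}  i≢j = ≡.refl
  δ-diff {i = suc i} {suc j} i≢j = δ-diff (i≢j ∘ ≡.cong suc)

  ⟪⟫-0 : ∀ {n} (y : Point n) → ⟪ y , (λ _ → 0#) ⟫ ≈ 0#
  ⟪⟫-0 {zero}  y = refl
  ⟪⟫-0 {suc n} y = trans (+-cong (zeroʳ _) (⟪⟫-0 (y ∘ suc))) (+-identityˡ 0#)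

  ⟪⟫-δ : ∀ {n} (y : Point n) i → ⟪ y , δ i ⟫ ≈ y i
  ⟪⟫-δ y zero    = trans (+-cong (*-identityʳ _) (⟪⟫-0 (y ∘ suc))) (+-identityʳ _)
  ⟪⟫-δ y (suc i) = trans (+-cong (zeroʳ _) (⟪⟫-δ (y ∘ suc) i)) (+-identityˡ _)

  sum≈⟪⟫1 : ∀ {n} (x : Point n) → sum x ≈ ⟪ (λ _ → 1#) , x ⟫
  sum≈⟪⟫1 x = sum-cong-≋ (λ i → sym (*-identityˡ (x i)))

  sum-δ : ∀ {n} (i : Fin n) → sum (δ i) ≈ 1#
  sum-δ i = trans (sum≈⟪⟫1 (δ i)) (⟪⟫-δ (λ _ → 1#) i)

  -- The points c·(1,…,1) + ε·δₚ and δᵢ + δⱼ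

  spike : ∀ {n} → ℝ → ℝ → Fin n → Point n
  spike c ε p i = c + ε * δ p i

  spike-at : ∀ {n} c ε (p : Fin n) → spike c ε p p ≈ c + ε
  spike-at c ε p = +-congˡ (trans (*-congˡ (reflexive (δ-same p))) (*-identityʳ ε))

  spike-off : ∀ {n} c ε {p i : Fin n} → p ≢ i → spike c ε p i ≈ c
  spike-off c ε p≢i =
    trans (+-congˡ (trans (*-congˡ (reflexive (δ-diff p≢i))) (zeroʳ ε))) (+-identityʳ c)

  sum-spike : ∀ {n} c ε (p : Fin n) → sum (spike c ε p) ≈ n ×′ 1# * c + ε
  sum-spike c ε p = trans (sum-shift c ε (δ p)) (+-congˡ (trans (*-congˡ (sum-δ p)) (*-identityʳ ε)))

  ⟪⟫-spike : ∀ {n} c ε (p : Fin n) y → ⟪ y , spike c ε p ⟫ ≈ c * sum y + ε * y p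
  ⟪⟫-spike c ε p y = trans (⟪⟫-shift c ε y (δ p)) (+-congˡ (*-congˡ (⟪⟫-δ y p)))

  pair : ∀ {n} → Fin n → Fin n → Point n
  pair i j k = δ i k + δ j k

  pair-comm : ∀ {n} (i j : Fin n) → pair i j ≋ pair j i
  pair-comm i j k = +-comm (δ i k) (δ j k)

  pair-left : ∀ {n} {i j : Fin n} → i ≢ j → pair i j i ≈ 1#
  pair-left {i = i} i≢j =
    trans (+-cong (reflexive (δ-same i)) (reflexive (δ-diff (i≢j ∘ ≡.sym)))) (+-identityʳ 1#)

  pair-right : ∀ {n} {i j : Fin n} → i ≢ j → pair i j j ≈ 1#
  pair-right {i = i} {j} i≢j = trans (pair-comm i j j) (pair-left (i≢j ∘ ≡.sym))

  pair-off : ∀ {n} {i j k : Fin n} → i ≢ k → j ≢ k → pair i j k ≈ 0#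
  pair-off i≢k j≢k = trans (+-cong (reflexive (δ-diff i≢k)) (reflexive (δ-diff j≢k))) (+-identityˡ 0#)

  pair-values : ∀ {n} {i j : Fin n} → i ≢ j → ∀ k →
                ((i ≡ k ⊎ j ≡ k) × pair i j k ≈ 1#) ⊎ (pair i j k ≈ 0#)
  pair-values {i = i} {j} i≢j k with i ≟ k | j ≟ k
  ... | yes ≡.refl | _          = inj₁ (inj₁ ≡.refl , pair-left i≢j)
  ... | no _       | yes ≡.refl = inj₁ (inj₂ ≡.refl , pair-right i≢j)
  ... | no i≢k     | no j≢k     = inj₂ (pair-off i≢k j≢k)

  ⟪⟫-pair : ∀ {n} (y : Point n) i j → ⟪ y , pair i j ⟫ ≈ y i + y j
  ⟪⟫-pair y i j = trans (⟪⟫-+ y (δ i) (δ j)) (+-cong (⟪⟫-δ y i) (⟪⟫-δ y j))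

  sum-pair : ∀ {n} (i j : Fin n) → sum (pair i j) ≈ 2#
  sum-pair i j = trans (sum≈⟪⟫1 (pair i j)) (⟪⟫-pair (λ _ → 1#) i j)

  pair-norm : ∀ {n} {i j : Fin n} → i ≢ j → ⟪ pair i j , pair i j ⟫ ≈ 2#
  pair-norm {i = i} {j} i≢j = trans (⟪⟫-pair (pair i j) i j) (+-cong (pair-left i≢j) (pair-right i≢j))

  dist²-pair : ∀ {n} (y : Point n) {i j} → i ≢ j →
               dist² y (pair i j) ≈ ⟪ y , y ⟫ + 2# - 2# * (y i + y j)
  dist²-pair y {i} {j} i≢j = trans (dist²-polar y (pair i j))
    (+-cong (+-congˡ (pair-norm i≢j)) (-‿cong (*-congˡ (⟪⟫-pair y i j))))

  2≉0 : ¬ (2# ≈ 0#)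
  2≉0 = suc×1≉0 1

  -- The nine additional points for n = 9

  3*⅓≈1 : 3# * ⅓ ≈ 1#
  3*⅓≈1 = ⁻¹-inverseʳ (suc×1≉0 2)

  ⅓-1≈-⅔ : ⅓ + - 1# ≈ -⅔
  ⅓-1≈-⅔ = combine 1# (solve 1 (λ t → (t :+ :- con (+ 1)) :- (:- (con (+ 2) :* t))
                                   := con (+ 1) :* (con (+ 3) :* t :- con (+ 1))) refl ⅓) 3*⅓≈1

  -- The solution c = 1/3, ε = -1 of the overview: eight coordinates 1/3 and one coordinate 1/3 - 1
  -- = -2/3.
  vee : Fin 9 → Point 9
  vee = spike ⅓ (- 1#)

  vee∈H₂ : ∀ p → vee p ∈ H₂ 9
  vee∈H₂ p = trans (sum-spike ⅓ (- 1#) p)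
    (combine 3# (solve 1 (λ t → (con (+ 9) :* t :+ :- con (+ 1)) :- con (+ 2)
                             := con (+ 3) :* (con (+ 3) :* t :- con (+ 1))) refl ⅓) 3*⅓≈1)

  ⟪⟫-vee : ∀ y → y ∈ H₂ 9 → ∀ p → ⟪ y , vee p ⟫ ≈ ⅓ * 2# - y p
  ⟪⟫-vee y Σy p = trans (⟪⟫-spike ⅓ (- 1#) p y)
    (+-cong (*-congˡ Σy) (solve 1 (λ a → :- con (+ 1) :* a := :- a) refl (y p)))

  vee-norm : ∀ p → ⟪ vee p , vee p ⟫ ≈ ⅓ * 2# - -⅔
  vee-norm p = trans (⟪⟫-vee (vee p) (vee∈H₂ p) p)
    (+-congˡ (-‿cong (trans (spike-at ⅓ (- 1#) p) ⅓-1≈-⅔)))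

  -- The squared norm 4/3 of `vee p` cancels against the constant part of the cross term. Points of
  -- `J̃₂ 9` have squared norm 2 and yₚ equal to 0 or 1, hence squared distance 2 or 4; another
  -- `vee` gives 4/3 + 2/3 = 2.
  dist²-vee : ∀ y → y ∈ H₂ 9 → ∀ p → dist² y (vee p) ≈ ⟪ y , y ⟫ + 2# * y p
  dist²-vee y Σy p = begin
    dist² y (vee p)                                           ≈⟨ dist²-polar y (vee p) ⟩
    ⟪ y , y ⟫ + ⟪ vee p , vee p ⟫ - 2# * ⟪ y , vee p ⟫
      ≈⟨ +-cong (+-congˡ (vee-norm p)) (-‿cong (*-congˡ (⟪⟫-vee y Σy p))) ⟩
    ⟪ y , y ⟫ + (⅓ * 2# - -⅔) - 2# * (⅓ * 2# - y p)
      ≈⟨ solve 3 (λ n t a → n :+ (t :* con (+ 2) :- (:- (con (+ 2) :* t)))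
                          :- con (+ 2) :* (t :* con (+ 2) :- a)
                         := n :+ con (+ 2) :* a) refl ⟪ y , y ⟫ ⅓ (y p) ⟩
    ⟪ y , y ⟫ + 2# * y p ∎

module JohnsonGraph (ℛ : Reals) where
  open Euclidean ℛ hiding (zero)
  open OrderedField ℛ
  open Geometry ℛ
  open import Algebra.Properties.CommutativeMonoid.Sum +-commutativeMonoid using (sum-cong-≋)

  -- Points whose coordinate pairs have one of two adjacent sums

  module TwoPairSums {m} (y : Point (3 ℕ.+ m)) (N : ℝ)
    (pairSum : ∀ {i j} → i ≢ j → 2# * (y i + y j) ≈ N ⊎ 2# * (y i + y j) + 2# ≈ N) where

    -- For a third index k, 2(yᵢ - yⱼ) is the difference of the doubled sums of yᵢ + yₖ and yⱼ + yₖ.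
    -- Both lie in {N, N - 2}, so it is 0, 2 or -2.
    coordinates : ∀ i j → y i ≈ y j ⊎ (y i ≈ y j + 1# ⊎ y j ≈ y i + 1#)
    coordinates i j with third-index i j
    ... | k , k≢i , k≢j with pairSum (k≢i ∘ ≡.sym) | pairSum (k≢j ∘ ≡.sym)
    ... | inj₁ p | inj₁ q = inj₁ (*-cancelˡ 2≉0 (combine₂ 1# (- 1#)
      (solve 4 (λ a b c n → con (+ 2) :* a :- con (+ 2) :* b
                         := con (+ 1) :* (con (+ 2) :* (a :+ c) :- n)
                         :+ (:- con (+ 1)) :* (con (+ 2) :* (b :+ c) :- n)) refl
        (y i) (y j) (y k) N) p q))
    ... | inj₂ p | inj₂ q = inj₁ (*-cancelˡ 2≉0 (combine₂ 1# (- 1#)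
      (solve 4 (λ a b c n → con (+ 2) :* a :- con (+ 2) :* b
                         := con (+ 1) :* (con (+ 2) :* (a :+ c) :+ con (+ 2) :- n)
                         :+ (:- con (+ 1)) :* (con (+ 2) :* (b :+ c) :+ con (+ 2) :- n)) refl
        (y i) (y j) (y k) N) p q))
    ... | inj₁ p | inj₂ q = inj₂ (inj₁ (*-cancelˡ 2≉0 (combine₂ 1# (- 1#)
      (solve 4 (λ a b c n → con (+ 2) :* a :- con (+ 2) :* (b :+ con (+ 1))
                         := con (+ 1) :* (con (+ 2) :* (a :+ c) :- n)
                         :+ (:- con (+ 1)) :* (con (+ 2) :* (b :+ c) :+ con (+ 2) :- n)) refl
        (y i) (y j) (y k) N) p q)))
    ... | inj₂ p | inj₁ q = inj₂ (inj₂ (*-cancelˡ 2≉0 (combine₂ 1# (- 1#)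
      (solve 4 (λ a b c n → con (+ 2) :* b :- con (+ 2) :* (a :+ con (+ 1))
                         := con (+ 1) :* (con (+ 2) :* (b :+ c) :- n)
                         :+ (:- con (+ 1)) :* (con (+ 2) :* (a :+ c) :+ con (+ 2) :- n)) refl
        (y i) (y j) (y k) N) q p)))

    -- The remaining possibility, y k one below y q, would put y k two below y p. Each of the three
    -- relations that `coordinates` allows between y p and y k then makes 2, 1 or 3 vanish.
    coordinates-from : ∀ {p q} → y p ≈ y q + 1# → ∀ k → y k ≈ y q ⊎ y k ≈ y q + 1#
    coordinates-from {p} {q} p≈q+1 k with coordinates k q | coordinates p k
    ... | inj₁ k≈q          | _                   = inj₁ k≈q
    ... | inj₂ (inj₁ k≈q+1) | _                   = inj₂ k≈q+1
    ... | inj₂ (inj₂ q≈k+1) | inj₁ p≈k            = ⊥-elim (2≉0 (combine₃ 1# (- 1#) (- 1#)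
      (solve 3 (λ p q k → con (+ 2) :- con (+ 0)
                       := con (+ 1) :* (p :- k)
                       :+ (:- con (+ 1)) :* (p :- (q :+ con (+ 1)))
                       :+ (:- con (+ 1)) :* (q :- (k :+ con (+ 1)))) refl (y p) (y q) (y k))
      p≈k p≈q+1 q≈k+1))
    ... | inj₂ (inj₂ q≈k+1) | inj₂ (inj₁ p≈k+1)   = ⊥-elim (0≉1 (sym (combine₃ 1# (- 1#) (- 1#)
      (solve 3 (λ p q k → con (+ 1) :- con (+ 0)
                       := con (+ 1) :* (p :- (k :+ con (+ 1)))
                       :+ (:- con (+ 1)) :* (p :- (q :+ con (+ 1)))
                       :+ (:- con (+ 1)) :* (q :- (k :+ con (+ 1)))) refl (y p) (y q) (y k))
      p≈k+1 p≈q+1 q≈k+1)))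
    ... | inj₂ (inj₂ q≈k+1) | inj₂ (inj₂ k≈p+1)   = ⊥-elim (suc×1≉0 2 (combine₃ (- 1#) (- 1#) (- 1#)
      (solve 3 (λ p q k → con (+ 3) :- con (+ 0)
                       := (:- con (+ 1)) :* (k :- (p :+ con (+ 1)))
                       :+ (:- con (+ 1)) :* (p :- (q :+ con (+ 1)))
                       :+ (:- con (+ 1)) :* (q :- (k :+ con (+ 1)))) refl (y p) (y q) (y k))
      k≈p+1 p≈q+1 q≈k+1))

    -- The doubled sums 4b + 4 and 4b are further apart than N and N - 2.
    extremes-clash : ∀ {b p q k l} → p ≢ k → l ≢ q → y p ≈ b + 1# → y k ≈ b + 1# →
                     y l ≈ b → y q ≈ b → ⊥
    extremes-clash {b} {p} {q} {k} {l} p≢k l≢q yp yk yl yq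
      with pairSum p≢k | pairSum l≢q
    ... | inj₁ s | inj₁ t = suc×1≉0 3 (combine₂ 1# (- 1#)
      (solve 2 (λ b n → con (+ 4) :- con (+ 0)
                     := con (+ 1) :* (con (+ 2) :* ((b :+ con (+ 1)) :+ (b :+ con (+ 1))) :- n)
                     :+ (:- con (+ 1)) :* (con (+ 2) :* (b :+ b) :- n)) refl b N)
      (trans (*-congˡ (+-cong (sym yp) (sym yk))) s)
      (trans (*-congˡ (+-cong (sym yl) (sym yq))) t))
    ... | inj₁ s | inj₂ t = 2≉0 (combine₂ 1# (- 1#)
      (solve 2 (λ b n → con (+ 2) :- con (+ 0)
                     := con (+ 1) :* (con (+ 2) :* ((b :+ con (+ 1)) :+ (b :+ con (+ 1))) :- n)
                     :+ (:- con (+ 1)) :* (con (+ 2) :* (b :+ b) :+ con (+ 2) :- n)) refl b N)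
      (trans (*-congˡ (+-cong (sym yp) (sym yk))) s)
      (trans (+-congʳ (*-congˡ (+-cong (sym yl) (sym yq)))) t))
    ... | inj₂ s | inj₁ t = suc×1≉0 5 (combine₂ 1# (- 1#)
      (solve 2 (λ b n → con (+ 6) :- con (+ 0)
                     := con (+ 1) :* (con (+ 2) :* ((b :+ con (+ 1)) :+ (b :+ con (+ 1))) :+ con (+ 2) :- n)
                     :+ (:- con (+ 1)) :* (con (+ 2) :* (b :+ b) :- n)) refl b N)
      (trans (+-congʳ (*-congˡ (+-cong (sym yp) (sym yk)))) s)
      (trans (*-congˡ (+-cong (sym yl) (sym yq))) t))
    ... | inj₂ s | inj₂ t = suc×1≉0 3 (combine₂ 1# (- 1#)
      (solve 2 (λ b n → con (+ 4) :- con (+ 0)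
                     := con (+ 1) :* (con (+ 2) :* ((b :+ con (+ 1)) :+ (b :+ con (+ 1))) :+ con (+ 2) :- n)
                     :+ (:- con (+ 1)) :* (con (+ 2) :* (b :+ b) :+ con (+ 2) :- n)) refl b N)
      (trans (+-congʳ (*-congˡ (+-cong (sym yp) (sym yk)))) s)
      (trans (+-congʳ (*-congˡ (+-cong (sym yl) (sym yq)))) t))

    IsSpike : ℝ → Set
    IsSpike ε = ∃[ c ] ∃[ p ] y ≋ spike c ε p

    -- If no coordinate is one above another, y is constant. Otherwise let y p = y q + 1. Either p
    -- is the only upper coordinate and forms an upward tip, or there is a second upper coordinate;
    -- then `extremes-clash` rules out a second lower one, and q is a downward tip.
    isSpike : IsSpike 0# ⊎ (IsSpike 1# ⊎ IsSpike (- 1#))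
    isSpike with any? (λ p → any? (λ q → y p ≟ʳ (y q + 1#)))
    ... | no none = inj₁ (y zero , zero , λ k → trans (constant k)
      (solve 2 (λ a d → a := a :+ con (+ 0) :* d) refl (y zero) (δ zero k)))
      where
      constant : ∀ k → y k ≈ y zero
      constant k with coordinates k zero
      ... | inj₁ eq        = eq
      ... | inj₂ (inj₁ eq) = ⊥-elim (none (k , zero , eq))
      ... | inj₂ (inj₂ eq) = ⊥-elim (none (zero , k , eq))
    ... | yes (p , q , p≈q+1) with any? (λ k → ¬? (p ≟ k) ×-dec (y k ≟ʳ (y q + 1#)))
    ...   | no none = inj₂ (inj₁ (y q , p , up))
      where
      up : y ≋ spike (y q) 1# p
      up k with p ≟ k | coordinates-from p≈q+1 k
      ... | yes ≡.refl | _          = trans p≈q+1 (sym (spike-at (y q) 1# p))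
      ... | no p≢k     | inj₁ k≈q   = trans k≈q (sym (spike-off (y q) 1# p≢k))
      ... | no p≢k     | inj₂ k≈q+1 = ⊥-elim (none (k , p≢k , k≈q+1))
    ...   | yes (k , p≢k , k≈q+1) = inj₂ (inj₂ (y q + 1# , q , down))
      where
      down : y ≋ spike (y q + 1#) (- 1#) q
      down l with q ≟ l | coordinates-from p≈q+1 l
      ... | yes ≡.refl | _          = trans
        (solve 1 (λ a → a := (a :+ con (+ 1)) :+ :- con (+ 1)) refl (y q))
        (sym (spike-at (y q + 1#) (- 1#) q))
      ... | no q≢l     | inj₁ l≈q   = ⊥-elim (extremes-clash p≢k (q≢l ∘ ≡.sym) p≈q+1 k≈q+1 l≈q refl)
      ... | no q≢l     | inj₂ l≈q+1 = trans l≈q+1 (sym (spike-off (y q + 1#) (- 1#) q≢l))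

    module SpikeArithmetic (y∈H : sum y ≈ 2#) (N≈ : N ≈ ⟪ y , y ⟫) c ε p (y≋ : y ≋ spike c ε p) where
      ν : ℝ
      ν = (3 ℕ.+ m) ×′ 1#

      sum-eq : ν * c + ε ≈ 2#
      sum-eq = trans (sym (sum-spike c ε p)) (trans (sym (sum-cong-≋ y≋)) y∈H)

      -- Only one factor of `⟪ y , y ⟫` is replaced by the spike; the other contributes through its
      -- coordinate sum 2. This keeps N linear in c and free of `ν`.
      norm-eq : N ≈ c * 2# + ε * (c + ε)
      norm-eq = trans N≈ (trans (⟪⟫-cong {x = y} {x′ = y} {y = y} (λ _ → refl) y≋)
        (trans (⟪⟫-spike c ε p y)
               (+-cong (*-congˡ y∈H) (*-congˡ (trans (y≋ p) (spike-at c ε p))))))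

      i j : Fin (3 ℕ.+ m)
      i = proj₁ (third-index p p)
      j = proj₁ (third-index p i)

      i≢p : i ≢ p
      i≢p = proj₁ (proj₂ (third-index p p))

      j≢p : j ≢ p
      j≢p = proj₁ (proj₂ (third-index p i))

      j≢i : j ≢ i
      j≢i = proj₂ (proj₂ (third-index p i))

      off : ∀ {k} → k ≢ p → c ≈ y k
      off k≢p = sym (trans (y≋ _) (spike-off c ε (k≢p ∘ ≡.sym)))

      flat-sum : 2# * (c + c) ≈ N ⊎ 2# * (c + c) + 2# ≈ N
      flat-sum = Sum.map (trans eq) (trans (+-congʳ eq)) (pairSum j≢i)
        where eq = *-congˡ (+-cong (off j≢p) (off i≢p))

      tip-sum : 2# * (c + (c + ε)) ≈ N ⊎ 2# * (c + (c + ε)) + 2# ≈ N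
      tip-sum = Sum.map (trans eq) (trans (+-congʳ eq)) (pairSum i≢p)
        where eq = *-congˡ (+-cong (off i≢p) (sym (trans (y≋ p) (spike-at c ε p))))

      0≤ν : 0# ≤ ν
      0≤ν = 0≤×1 (3 ℕ.+ m)

      0<2ν+4 : 0# < (ν + ν) + 4 ×′ 1#
      0<2ν+4 = +-pos (+-nonneg 0≤ν 0≤ν) (0<×1 3)

    module _ (y∈H : sum y ≈ 2#) (N≈ : N ≈ ⟪ y , y ⟫) where

      -- Here N = 2c and `ν` c = 2. The flat sum forces c = 0 or c = -1; multiplying by `ν`
      -- eliminates c without division and leaves 4 = 0 or 2`ν` + 4 = 0.
      no-constant : ¬ IsSpike 0#
      no-constant (c , p , y≋) = excluded flat-sum
        where
        open SpikeArithmetic y∈H N≈ c 0# p y≋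
        excluded : 2# * (c + c) ≈ N ⊎ 2# * (c + c) + 2# ≈ N → ⊥
        excluded (inj₁ eq) = suc×1≉0 3 (combine₃ (- 2#) ν ν
          (solve 3 (λ ν c n → con (+ 4) :- con (+ 0)
            := (:- con (+ 2)) :* ((ν :* c :+ con (+ 0)) :- con (+ 2))
            :+ ν :* (con (+ 2) :* (c :+ c) :- n)
            :+ ν :* (n :- (c :* con (+ 2) :+ con (+ 0) :* (c :+ con (+ 0))))) refl ν c N)
          sum-eq eq norm-eq)
        excluded (inj₂ eq) = <⇒≉ 0<2ν+4 (sym (combine₃ (- 2#) ν ν
          (solve 3 (λ ν c n → ((ν :+ ν) :+ con (+ 4)) :- con (+ 0)
            := (:- con (+ 2)) :* ((ν :* c :+ con (+ 0)) :- con (+ 2))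
            :+ ν :* (con (+ 2) :* (c :+ c) :+ con (+ 2) :- n)
            :+ ν :* (n :- (c :* con (+ 2) :+ con (+ 0) :* (c :+ con (+ 0))))) refl ν c N)
          sum-eq eq norm-eq))

      -- Here N = 3c + 1 and `ν` c = 1. The pair through the tip forces c = -1 or c = -3, so `ν`
      -- would be negative either way. A pair away from the tip would leave the candidate c = 1, `ν`
      -- = 1, which positivity does not refute.
      no-upward : ¬ IsSpike 1#
      no-upward (c , p , y≋) = excluded tip-sum
        where
        open SpikeArithmetic y∈H N≈ c 1# p y≋
        excluded : 2# * (c + (c + 1#)) ≈ N ⊎ 2# * (c + (c + 1#)) + 2# ≈ N → ⊥
        excluded (inj₁ eq) = <⇒≉ (+-pos 0≤ν 0<1) (sym (combine₃ (- 1#) ν ν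
          (solve 3 (λ ν c n → (ν :+ con (+ 1)) :- con (+ 0)
            := (:- con (+ 1)) :* ((ν :* c :+ con (+ 1)) :- con (+ 2))
            :+ ν :* (con (+ 2) :* (c :+ (c :+ con (+ 1))) :- n)
            :+ ν :* (n :- (c :* con (+ 2) :+ con (+ 1) :* (c :+ con (+ 1))))) refl ν c N)
          sum-eq eq norm-eq))
        excluded (inj₂ eq) = <⇒≉ (+-pos (+-nonneg (+-nonneg 0≤ν 0≤ν) 0≤ν) 0<1) (sym (combine₃ (- 1#) ν ν
          (solve 3 (λ ν c n → (((ν :+ ν) :+ ν) :+ con (+ 1)) :- con (+ 0)
            := (:- con (+ 1)) :* ((ν :* c :+ con (+ 1)) :- con (+ 2))
            :+ ν :* (con (+ 2) :* (c :+ (c :+ con (+ 1))) :+ con (+ 2) :- n)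
            :+ ν :* (n :- (c :* con (+ 2) :+ con (+ 1) :* (c :+ con (+ 1))))) refl ν c N)
          sum-eq eq norm-eq))

      -- Here N = c + 1 and `ν` c = 3. For a pair away from the tip, 4c = N gives c = 1/3 and `ν` =
      -- 9, while 4c + 2 = N gives c = -1/3 and `ν` = -9, contradicting positivity.
      downward : IsSpike (- 1#) → 3 ℕ.+ m ≡ 9 × (∃[ p ] y ≋ spike ⅓ (- 1#) p)
      downward (c , p , y≋) = conclude flat-sum
        where
        open SpikeArithmetic y∈H N≈ c (- 1#) p y≋
        conclude : 2# * (c + c) ≈ N ⊎ 2# * (c + c) + 2# ≈ N →
                   3 ℕ.+ m ≡ 9 × (∃[ p ] y ≋ spike ⅓ (- 1#) p)
        conclude (inj₁ eq) = ×1-injective (3 ℕ.+ m) 9 ν≈9 , p , λ k → trans (y≋ k) (+-congʳ c≈⅓)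
          where
          3c≈1 : 3# * c ≈ 1#
          3c≈1 = combine₂ 1# 1#
            (solve 2 (λ c n → con (+ 3) :* c :- con (+ 1)
              := con (+ 1) :* (con (+ 2) :* (c :+ c) :- n)
              :+ con (+ 1) :* (n :- (c :* con (+ 2) :+ (:- con (+ 1)) :* (c :+ :- con (+ 1))))) refl c N)
            eq norm-eq
          c≈⅓ : c ≈ ⅓
          c≈⅓ = *-cancelˡ (suc×1≉0 2) (trans 3c≈1 (sym 3*⅓≈1))
          ν≈9 : ν ≈ 9 ×′ 1#
          ν≈9 = combine₂ 3# (- ν)
            (solve 2 (λ ν c → ν :- con (+ 9)
              := con (+ 3) :* ((ν :* c :+ :- con (+ 1)) :- con (+ 2))
              :+ (:- ν) :* (con (+ 3) :* c :- con (+ 1))) refl ν c)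
            sum-eq 3c≈1
        conclude (inj₂ eq) = ⊥-elim (<⇒≉ (+-pos 0≤ν (0<×1 8)) (sym (combine₃ (- 3#) ν ν
          (solve 3 (λ ν c n → (ν :+ con (+ 9)) :- con (+ 0)
            := (:- con (+ 3)) :* ((ν :* c :+ :- con (+ 1)) :- con (+ 2))
            :+ ν :* (con (+ 2) :* (c :+ c) :+ con (+ 2) :- n)
            :+ ν :* (n :- (c :* con (+ 2) :+ (:- con (+ 1)) :* (c :+ :- con (+ 1))))) refl ν c N)
          sum-eq eq norm-eq)))

      only-vee : 3 ℕ.+ m ≡ 9 × (∃[ p ] y ≋ spike ⅓ (- 1#) p)
      only-vee = [ ⊥-elim ∘ no-constant , [ ⊥-elim ∘ no-upward , downward ]′ ]′ isSpike

  -- Membership in the two orbits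

  lookup-replicate-++[] : ∀ m (a : ℝ) l → lookup (replicate m a ++ []) l ≡ a
  lookup-replicate-++[] (suc m) a zero    = ≡.refl
  lookup-replicate-++[] (suc m) a (suc l) = lookup-replicate-++[] m a l

  length-replicate-++[] : ∀ m (a : ℝ) → length (replicate m a ++ []) ≡ m
  length-replicate-++[] m a =
    ≡.trans (≡.cong length (++-identityʳ (replicate m a))) (length-replicate m)

  J̃₂⁻ : ∀ {m} {x : Point (2 ℕ.+ m)} → x ∈ J̃₂ (2 ℕ.+ m) →
        ∃[ i ] ∃[ j ] (i ≢ j × x ≋ pair i j)
  J̃₂⁻ {m} {x} (π , x≈) = i , j , i≢j , eq
    where
    i = π ⟨$⟩ˡ zero
    j = π ⟨$⟩ˡ suc zero

    from-π : ∀ {k l} → π ⟨$⟩ʳ k ≡ l → π ⟨$⟩ˡ l ≡ k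
    from-π eq = ≡.trans (≡.cong (π ⟨$⟩ˡ_) (≡.sym eq)) (Perm.inverseˡ π)

    to-π : ∀ {k l} → π ⟨$⟩ˡ l ≡ k → π ⟨$⟩ʳ k ≡ l
    to-π eq = ≡.trans (≡.cong (π ⟨$⟩ʳ_) (≡.sym eq)) (Perm.inverseʳ π)

    i≢j : i ≢ j
    i≢j i≡j with () ← ≡.trans (≡.sym (to-π i≡j)) (Perm.inverseʳ π {suc zero})

    eq : x ≋ pair i j
    eq k with π ⟨$⟩ʳ k in πk | x≈ k
    ... | zero        | xk = trans xk (≡.subst (λ k → 1# ≈ pair i j k) (from-π πk) (sym (pair-left i≢j)))
    ... | suc zero    | xk = trans xk (≡.subst (λ k → 1# ≈ pair i j k) (from-π πk) (sym (pair-right i≢j)))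
    ... | suc (suc l) | xk = trans xk (trans (reflexive (lookup-replicate-++[] m 0# l))
                               (sym (pair-off (away λ ()) (away λ ()))))
      where
      away : ∀ {l′} → l′ ≢ suc (suc l) → π ⟨$⟩ˡ l′ ≢ k
      away l′≢ eq = l′≢ (≡.trans (≡.sym (to-π eq)) πk)

  -- Two insertions send i to place 0 and j to place 1. After removal of i, the index j is
  -- renumbered as `punchOut i≢j`. The block of zeros has length m only propositionally, hence the
  -- cast on the rest.
  J̃₂⁺ : ∀ {m} {x : Point (2 ℕ.+ m)} {i j} → i ≢ j → x ≋ pair i j → x ∈ J̃₂ (2 ℕ.+ m)
  J̃₂⁺ {m} {x} {i} {j} i≢j x≋ = π , λ k → trans (x≋ k) (values k)
    where
    j′ = punchOut i≢j
    tail-π = cast-id (≡.sym (length-replicate-++[] m 0#))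
    π′ = insert j′ zero tail-π
    π = insert i zero π′

    as : List ℝ
    as = entries ((1# , 2) ∷ (0# , m) ∷ [])

    at : ∀ {k l} → π ⟨$⟩ʳ k ≡ l → ∀ {a} → a ≈ lookup as l → a ≈ lookup as (π ⟨$⟩ʳ k)
    at ≡.refl eq = eq

    values : ∀ k → pair i j k ≈ lookup as (π ⟨$⟩ʳ k)
    values = punchIn-elim _ i
      (at (insert-self i zero π′) (pair-left i≢j))
      (punchIn-elim _ j′
        (at (≡.trans (insert-punchIn i zero π′ j′) (≡.cong suc (insert-self j′ zero tail-π)))
          (≡.subst (λ k → pair i j k ≈ 1#) (≡.sym (punchIn-punchOut i≢j)) (pair-right i≢j)))
        (λ k → at (≡.trans (insert-punchIn i zero π′ (punchIn j′ k))
                           (≡.cong suc (insert-punchIn j′ zero tail-π k)))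
          (trans (pair-off (punchInᵢ≢i i _ ∘ ≡.sym) (avoids-j k))
            (reflexive (≡.sym (lookup-replicate-++[] m 0# (tail-π ⟨$⟩ʳ k)))))))
      where
      avoids-j : ∀ k → j ≢ punchIn i (punchIn j′ k)
      avoids-j k eq = punchInᵢ≢i j′ k (≡.sym
        (punchIn-injective i j′ (punchIn j′ k) (≡.trans (punchIn-punchOut i≢j) eq)))

  V : PointSet 9
  V = ((⅓ , 8) ∷ (-⅔ , 1) ∷ []) ᴾ

  lookup-V : ∀ l → lookup (entries ((⅓ , 8) ∷ (-⅔ , 1) ∷ [])) (punchIn (Fin.fromℕ 8) l) ≡ ⅓
  lookup-V zero = ≡.refl
  lookup-V (suc zero) = ≡.refl
  lookup-V (suc (suc zero)) = ≡.refl
  lookup-V (suc (suc (suc zero))) = ≡.refl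
  lookup-V (suc (suc (suc (suc zero)))) = ≡.refl
  lookup-V (suc (suc (suc (suc (suc zero))))) = ≡.refl
  lookup-V (suc (suc (suc (suc (suc (suc zero)))))) = ≡.refl
  lookup-V (suc (suc (suc (suc (suc (suc (suc zero))))))) = ≡.refl

  vee-at : ∀ p → vee p p ≈ -⅔
  vee-at p = trans (spike-at ⅓ (- 1#) p) ⅓-1≈-⅔

  vee-off : ∀ p {i} → p ≢ i → vee p i ≈ ⅓
  vee-off p = spike-off ⅓ (- 1#)

  V⁻ : ∀ {x} → x ∈ V → ∃[ p ] x ≋ vee p
  V⁻ {x} (π , x≈) = p , λ k → trans (x≈ k) (values (π ⟨$⟩ʳ k) k ≡.refl)
    where
    -- The entry -2/3 stands last in the list, at index 8.
    p = π ⟨$⟩ˡ Fin.fromℕ 8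

    values : ∀ l k → π ⟨$⟩ʳ k ≡ l → lookup (entries ((⅓ , 8) ∷ (-⅔ , 1) ∷ [])) l ≈ vee p k
    values = punchIn-elim _ (Fin.fromℕ 8)
      (λ k πk → ≡.subst (λ k → -⅔ ≈ vee p k)
        (≡.trans (≡.cong (π ⟨$⟩ˡ_) (≡.sym πk)) (Perm.inverseˡ π)) (sym (vee-at p)))
      (λ l k πk → trans (reflexive (lookup-V l)) (sym (vee-off p λ p≡k →
        punchInᵢ≢i (Fin.fromℕ 8) l
          (≡.trans (≡.sym πk) (≡.trans (≡.cong (π ⟨$⟩ʳ_) (≡.sym p≡k)) (Perm.inverseʳ π))))))

  V⁺ : ∀ {x p} → x ≋ vee p → x ∈ V
  V⁺ {x} {p} x≋ = π , λ k → trans (x≋ k) (values k)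
    where
    π : Permutation 9 9
    π = insert p (Fin.fromℕ 8) Perm.id

    as : List ℝ
    as = entries ((⅓ , 8) ∷ (-⅔ , 1) ∷ [])

    at : ∀ {k l} → π ⟨$⟩ʳ k ≡ l → ∀ {a} → a ≈ lookup as l → a ≈ lookup as (π ⟨$⟩ʳ k)
    at ≡.refl eq = eq

    values : ∀ k → vee p k ≈ lookup as (π ⟨$⟩ʳ k)
    values = punchIn-elim _ p
      (at (insert-self p (Fin.fromℕ 8) Perm.id) (vee-at p))
      (λ k → at (insert-punchIn p (Fin.fromℕ 8) Perm.id k)
        (trans (vee-off p (punchInᵢ≢i p k ∘ ≡.sym)) (reflexive (≡.sym (lookup-V k)))))

  -- Counting

  pair-support : ∀ {n} {i j k l : Fin n} → i ≢ j → k ≢ l → pair i j ≋ pair k l →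
                 (k ≡ i ⊎ l ≡ i) × (k ≡ j ⊎ l ≡ j)
  pair-support {i = i} {j} i≢j k≢l eq with pair-values k≢l i | pair-values k≢l j
  ... | inj₁ (k∨l≡i , _) | inj₁ (k∨l≡j , _) = k∨l≡i , k∨l≡j
  ... | inj₂ kl[i]≈0     | _            =
    ⊥-elim (0≉1 (sym (trans (sym (pair-left i≢j)) (trans (eq i) kl[i]≈0))))
  ... | inj₁ _           | inj₂ kl[j]≈0 =
    ⊥-elim (0≉1 (sym (trans (sym (pair-right i≢j)) (trans (eq j) kl[j]≈0))))

  pair-injective : ∀ {n} {i j k l : Fin n} → i Fin.< j → k Fin.< l → pair i j ≋ pair k l →
                   (i , j) ≡ (k , l)
  pair-injective i<j k<l eq with pair-support (<⇒≢ i<j) (<⇒≢ k<l) eq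
  ... | inj₁ ≡.refl , inj₂ ≡.refl = ≡.refl
  ... | inj₁ ≡.refl , inj₁ ≡.refl = ⊥-elim (<⇒≢ i<j ≡.refl)
  ... | inj₂ ≡.refl , inj₂ ≡.refl = ⊥-elim (<⇒≢ i<j ≡.refl)
  ... | inj₂ ≡.refl , inj₁ ≡.refl = ⊥-elim (<-asym i<j k<l)

  J̃₂-size : ∀ m → HasPoints (length (increasingPairs (2 ℕ.+ m))) (J̃₂ (2 ℕ.+ m))
  J̃₂-size m = f , inj , λ x → mk⇔ to from
    where
    n = 2 ℕ.+ m

    f : Fin (length (increasingPairs n)) → Point n
    f a = pair (proj₁ (lookup (increasingPairs n) a)) (proj₂ (lookup (increasingPairs n) a))

    increasing : ∀ a → proj₁ (lookup (increasingPairs n) a) Fin.< proj₂ (lookup (increasingPairs n) a)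
    increasing a = ∈-increasingPairs⁻ (∈-lookup a)

    inj : Injective _≡_ _≋_ f
    inj {a} {b} eq = lookup-injective (increasingPairs-unique n)
      (pair-injective (increasing a) (increasing b) eq)

    enumerated : ∀ {i j} → i Fin.< j → ∃[ a ] pair i j ≋ f a
    enumerated i<j = index i,j∈ , λ k → reflexive
      (≡.cong (λ (i , j) → pair i j k) (lookup-index i,j∈))
      where i,j∈ = ∈-increasingPairs⁺ i<j

    to : ∀ {x} → x ∈ J̃₂ n → ∃[ a ] x ≋ f a
    to x∈J with J̃₂⁻ x∈J
    ... | i , j , i≢j , x≋ with <-cmp i j
    ...   | tri< i<j _ _ = let a , eq = enumerated i<j in a , λ k → trans (x≋ k) (eq k)
    ...   | tri≈ _ i≡j _ = ⊥-elim (i≢j i≡j)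
    ...   | tri> _ _ j<i = let a , eq = enumerated j<i in
                           a , λ k → trans (x≋ k) (trans (pair-comm i j k) (eq k))

    from : ∀ {x} → ∃[ a ] x ≋ f a → x ∈ J̃₂ n
    from (a , eq) = J̃₂⁺ (<⇒≢ (increasing a)) eq

  vee-injective : ∀ {p q} → vee p ≋ vee q → p ≡ q
  vee-injective {p} {q} eq with p ≟ q
  ... | yes p≡q = p≡q
  ... | no p≢q = ⊥-elim (0≉1 (sym (combine 1#
    (solve 1 (λ t → con (+ 1) :- con (+ 0) := con (+ 1) :* (t :- (t :+ :- con (+ 1)))) refl ⅓)
    (trans (sym (vee-off q (p≢q ∘ ≡.sym))) (trans (sym (eq p)) (spike-at ⅓ (- 1#) p))))))

  V-size : HasPoints 9 V
  V-size = vee , vee-injective , λ x → mk⇔ V⁻ (λ (p , x≋) → V⁺ {p = p} x≋)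

  -- A coordinate outside the pair tells them apart: it is 0 on the left, but 1/3 or -2/3 on the
  -- right.
  pair≉vee : ∀ {i j p} → i ≢ j → ¬ (pair i j ≋ vee p)
  pair≉vee {i} {j} {p} i≢j eq with third-index i j
  ... | k , k≢i , k≢j with p ≟ k
  ...   | yes ≡.refl = 2≉0 (combine₂ 1# 3#
    (solve 1 (λ t → con (+ 2) :- con (+ 0) := con (+ 1) :* (con (+ 3) :* t :- con (+ 1))
                    :+ con (+ 3) :* (con (+ 0) :- (t :+ :- con (+ 1)))) refl ⅓)
    3*⅓≈1 (trans (sym at-k) (trans (eq k) (spike-at ⅓ (- 1#) p))))
    where at-k = pair-off (k≢i ∘ ≡.sym) (k≢j ∘ ≡.sym)
  ...   | no p≢k = 0≉1 (trans (sym (zeroʳ 3#)) (trans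
    (*-congˡ (trans (sym at-k) (trans (eq k) (vee-off p p≢k)))) 3*⅓≈1))
    where at-k = pair-off (k≢i ∘ ≡.sym) (k≢j ∘ ≡.sym)

  M₄₅-size : HasPoints 45 M₄₅
  -- The length of `increasingPairs 9` evaluates to 36, so 36 + 9 = 45 holds by computation.
  M₄₅-size = HasSize-∪ {S = ≋-setoid 9} (J̃₂-size 7) V-size disjoint
    where
    disjoint : ∀ {x y} → x ∈ J̃₂ 9 → y ∈ V → ¬ (x ≋ y)
    disjoint x∈J y∈V x≋y with J̃₂⁻ x∈J | V⁻ y∈V
    ... | i , j , i≢j , x≋ | p , y≋ =
      pair≉vee {p = p} i≢j (λ k → trans (sym (x≋ k)) (trans (x≋y k) (y≋ k)))

  -- Two-distance sets with squared distances 2 and 4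

  4# : ℝ
  4# = 4 ×′ 1#

  Realises : ∀ {n} → PointSet n → ℝ → Set
  Realises X r = ∃[ x ] ∃[ y ] (x ∈ X × y ∈ X × dist² x y ≈ r)

  Realises-mono : ∀ {n} {X Y : PointSet n} {r} → X ⊆ Y → Realises X r → Realises Y r
  Realises-mono X⊆Y (x , y , x∈ , y∈ , eq) = x , y , X⊆Y x∈ , X⊆Y y∈ , eq

  -- The root-free counterpart of the two-distance property; for sets that realise both 2 and 4, the
  -- lemmas in `Roots` translate in either direction.
  Only2And4 : ∀ {n} → PointSet n → Set
  Only2And4 X = ∀ {x y} → x ∈ X → y ∈ X → ¬ (x ≋ y) → dist² x y ≈ 2# ⊎ dist² x y ≈ 4#

  realises⇒distance : ∀ {n} {X : PointSet n} {r d} → ¬ (r ≈ 0#) → Realises X r → 0# ≤ d → d * d ≈ r →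
                      Distances X d
  realises⇒distance r≉0 (x , y , x∈ , y∈ , eq) 0≤d dd≈r =
    x , y , x∈ , y∈ ,
    (λ x≋y → r≉0 (trans (sym eq)
      (trans (dist²-cong {x = x} {y} {y} {y} x≋y (λ _ → refl)) (dist²-self y)))) ,
    0≤d , trans dd≈r (sym eq)

  4≉2 : ¬ (4# ≈ 2#)
  4≉2 eq with () ← ×1-injective 4 2 eq

  module Roots (d₂ d₄ : ℝ) (0≤d₂ : 0# ≤ d₂) (0≤d₄ : 0# ≤ d₄)
               (d₂² : d₂ * d₂ ≈ 2#) (d₄² : d₄ * d₄ ≈ 4#) where
    d₂≉d₄ : ¬ (d₂ ≈ d₄)
    d₂≉d₄ eq = 4≉2 (trans (sym d₄²) (trans (sym (*-cong eq eq)) d₂²))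

    only2And4⇒twoDistances : ∀ {n} {X : PointSet n} → Realises X 2# → Realises X 4# → Only2And4 X →
                             Subsets.HasSize setoid 2 (Distances X)
    only2And4⇒twoDistances {X = X} two four only = f , inj , λ d → mk⇔ to (from d)
      where
      f : Fin 2 → ℝ
      f zero       = d₂
      f (suc zero) = d₄

      inj : Injective _≡_ _≈_ f
      inj {zero}     {zero}     _  = ≡.refl
      inj {zero}     {suc zero} eq = ⊥-elim (d₂≉d₄ eq)
      inj {suc zero} {zero}     eq = ⊥-elim (d₂≉d₄ (sym eq))
      inj {suc zero} {suc zero} _  = ≡.refl

      to : ∀ {d} → Distances X d → ∃[ i ] d ≈ f i
      to (x , y , x∈ , y∈ , x≉y , 0≤d , dd≈) with only x∈ y∈ x≉y
      ... | inj₁ eq = zero , square-injective 0≤d 0≤d₂ (trans dd≈ (trans eq (sym d₂²)))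
      ... | inj₂ eq = suc zero , square-injective 0≤d 0≤d₄ (trans dd≈ (trans eq (sym d₄²)))

      from : ∀ d → ∃[ i ] d ≈ f i → Distances X d
      from d (zero , d≈) = realises⇒distance 2≉0 two
        (≤-respʳ (sym d≈) 0≤d₂) (trans (*-cong d≈ d≈) d₂²)
      from d (suc zero , d≈) = realises⇒distance (suc×1≉0 3) four
        (≤-respʳ (sym d≈) 0≤d₄) (trans (*-cong d≈ d≈) d₄²)

    -- Pigeonhole: the roots of 2 and 4 are distinct and occupy both places of the enumeration, so
    -- the distance of x and y shares its place with one of them. That distance comes from `sqrt`.
    twoDistances⇒only2And4 : ∀ {n} {X : PointSet n} → Realises X 2# → Realises X 4# →
                             Subsets.HasSize setoid 2 (Distances X) → Only2And4 X
    twoDistances⇒only2And4 {X = X} two four (f , _ , enum) {x} {y} x∈ y∈ x≉y =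
      let d , 0≤d , dd≈ = sqrt (dist²-nonneg x y)
          i , d≈  = Equivalence.to (enum d) (x , y , x∈ , y∈ , x≉y , 0≤d , dd≈)
          j , d₂≈ = Equivalence.to (enum d₂) (realises⇒distance 2≉0 two 0≤d₂ d₂²)
          k , d₄≈ = Equivalence.to (enum d₄) (realises⇒distance (suc×1≉0 3) four 0≤d₄ d₄²)
      in Sum.map (λ i≡j → squares dd≈ d₂² (trans d≈ (trans (reflexive (≡.cong f i≡j)) (sym d₂≈))))
                 (λ i≡k → squares dd≈ d₄² (trans d≈ (trans (reflexive (≡.cong f i≡k)) (sym d₄≈))))
                 (pigeon i j k λ j≡k → d₂≉d₄ (trans d₂≈ (trans (reflexive (≡.cong f j≡k)) (sym d₄≈))))
      where
      squares : ∀ {d e r s} → d * d ≈ r → e * e ≈ s → d ≈ e → r ≈ s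
      squares dd≈r ee≈s d≈e = trans (sym dd≈r) (trans (*-cong d≈e d≈e) ee≈s)

      pigeon : ∀ (i j k : Fin 2) → j ≢ k → i ≡ j ⊎ i ≡ k
      pigeon zero       zero       _          _   = inj₁ ≡.refl
      pigeon zero       (suc zero) zero       _   = inj₂ ≡.refl
      pigeon zero       (suc zero) (suc zero) j≢k = ⊥-elim (j≢k ≡.refl)
      pigeon (suc zero) (suc zero) _          _   = inj₁ ≡.refl
      pigeon (suc zero) zero       (suc zero) _   = inj₂ ≡.refl
      pigeon (suc zero) zero       zero       j≢k = ⊥-elim (j≢k ≡.refl)

  -- Distances within the Johnson graph and the 45 points

  J̃₂⊆H₂ : ∀ {m} → J̃₂ (2 ℕ.+ m) ⊆ H₂ (2 ℕ.+ m)
  J̃₂⊆H₂ x∈J with i , j , _ , x≋ ← J̃₂⁻ x∈J = trans (sum-cong-≋ x≋) (sum-pair i j)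

  V⊆H₂ : V ⊆ H₂ 9
  V⊆H₂ x∈V with p , x≋ ← V⁻ x∈V = trans (sum-cong-≋ x≋) (vee∈H₂ p)

  -- Here a + b counts the indices that the two pairs share.
  dist²-pairs : ∀ {n} {i j k l : Fin n} {a b} → i ≢ j → k ≢ l →
                pair i j k ≈ a → pair i j l ≈ b → dist² (pair i j) (pair k l) ≈ 4# - 2# * (a + b)
  dist²-pairs {i = i} {j} {k} {l} i≢j k≢l ea eb = trans (dist²-pair (pair i j) k≢l)
    (+-cong (trans (+-congʳ (pair-norm i≢j)) (solve 0 (con (+ 2) :+ con (+ 2) := con (+ 4)) refl))
            (-‿cong (*-congˡ (+-cong ea eb))))

  4-2*[1+0]≈2 : 4# - 2# * (1# + 0#) ≈ 2#
  4-2*[1+0]≈2 = solve 0 (con (+ 4) :- con (+ 2) :* (con (+ 1) :+ con (+ 0)) := con (+ 2)) refl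

  4-2*[0+1]≈2 : 4# - 2# * (0# + 1#) ≈ 2#
  4-2*[0+1]≈2 = solve 0 (con (+ 4) :- con (+ 2) :* (con (+ 0) :+ con (+ 1)) := con (+ 2)) refl

  4-2*[0+0]≈4 : 4# - 2# * (0# + 0#) ≈ 4#
  4-2*[0+0]≈4 = solve 0 (con (+ 4) :- con (+ 2) :* (con (+ 0) :+ con (+ 0)) := con (+ 4)) refl

  pairs-only2And4 : ∀ {n} {i j k l : Fin n} → i ≢ j → k ≢ l → ¬ (pair i j ≋ pair k l) →
                    dist² (pair i j) (pair k l) ≈ 2# ⊎ dist² (pair i j) (pair k l) ≈ 4#
  pairs-only2And4 {i = i} {j} {k} {l} i≢j k≢l distinct with pair-values i≢j k | pair-values i≢j l
  ... | inj₂ ek       | inj₂ el       = inj₂ (trans (dist²-pairs i≢j k≢l ek el) 4-2*[0+0]≈4)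
  ... | inj₁ (_ , ek) | inj₂ el       = inj₁ (trans (dist²-pairs i≢j k≢l ek el) 4-2*[1+0]≈2)
  ... | inj₂ ek       | inj₁ (_ , el) = inj₁ (trans (dist²-pairs i≢j k≢l ek el) 4-2*[0+1]≈2)
  ... | inj₁ (inj₁ ≡.refl , _) | inj₁ (inj₁ ≡.refl , _) = ⊥-elim (k≢l ≡.refl)
  ... | inj₁ (inj₁ ≡.refl , _) | inj₁ (inj₂ ≡.refl , _) = ⊥-elim (distinct (λ _ → refl))
  ... | inj₁ (inj₂ ≡.refl , _) | inj₁ (inj₁ ≡.refl , _) = ⊥-elim (distinct (pair-comm i j))
  ... | inj₁ (inj₂ ≡.refl , _) | inj₁ (inj₂ ≡.refl , _) = ⊥-elim (k≢l ≡.refl)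

  -- Orbit points are pairs or vees only up to `≋`; this carries the computed distances back to
  -- them.
  2-or-4-resp-≋ : ∀ {n} {x y : Point n} {x′ y′} → x ≋ x′ → y ≋ y′ → ¬ (x ≋ y) →
                    (¬ (x′ ≋ y′) → dist² x′ y′ ≈ 2# ⊎ dist² x′ y′ ≈ 4#) →
                    dist² x y ≈ 2# ⊎ dist² x y ≈ 4#
  2-or-4-resp-≋ {x = x} {y} {x′} {y′} x≋ y≋ x≉y k = Sum.map (trans d≈) (trans d≈)
    (k λ x′≋y′ → x≉y (λ i → trans (x≋ i) (trans (x′≋y′ i) (sym (y≋ i)))))
    where d≈ = dist²-cong {x = x} {x′} {y} {y′} x≋ y≋

  J̃₂-only2And4 : ∀ {m} → Only2And4 (J̃₂ (2 ℕ.+ m))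
  J̃₂-only2And4 x∈ y∈ x≉y with J̃₂⁻ x∈ | J̃₂⁻ y∈
  ... | _ , _ , i≢j , x≋ | _ , _ , k≢l , y≋ = 2-or-4-resp-≋ x≋ y≋ x≉y (pairs-only2And4 i≢j k≢l)

  pair-vee : ∀ {i j} → i ≢ j → ∀ p → dist² (pair i j) (vee p) ≈ 2# ⊎ dist² (pair i j) (vee p) ≈ 4#
  pair-vee {i} {j} i≢j p with pair-values i≢j p
  ... | inj₁ (_ , e) = inj₂ (trans (dist²-vee (pair i j) (sum-pair i j) p)
    (trans (+-cong (pair-norm i≢j) (*-congˡ e))
      (solve 0 (con (+ 2) :+ con (+ 2) :* con (+ 1) := con (+ 4)) refl)))
  ... | inj₂ e = inj₁ (trans (dist²-vee (pair i j) (sum-pair i j) p)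
    (trans (+-cong (pair-norm i≢j) (*-congˡ e))
      (solve 0 (con (+ 2) :+ con (+ 2) :* con (+ 0) := con (+ 2)) refl)))

  vee-vee : ∀ p q → ¬ (vee p ≋ vee q) → dist² (vee p) (vee q) ≈ 2#
  vee-vee p q p≉q = trans (dist²-vee (vee p) (vee∈H₂ p) q)
    (trans (+-cong (vee-norm p) (*-congˡ (vee-off p p≢q)))
      (combine 2#
        (solve 1 (λ t → ((t :* con (+ 2) :- (:- (con (+ 2) :* t))) :+ con (+ 2) :* t) :- con (+ 2)
                               := con (+ 2) :* (con (+ 3) :* t :- con (+ 1))) refl ⅓) 3*⅓≈1))
    where
    p≢q : p ≢ q
    p≢q ≡.refl = p≉q (λ _ → refl)

  M₄₅-only2And4 : Only2And4 M₄₅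
  M₄₅-only2And4 (inj₁ x∈J) (inj₁ y∈J) x≉y = J̃₂-only2And4 x∈J y∈J x≉y
  M₄₅-only2And4 (inj₁ x∈J) (inj₂ y∈V) x≉y with J̃₂⁻ x∈J | V⁻ y∈V
  ... | _ , _ , i≢j , x≋ | p , y≋ = 2-or-4-resp-≋ x≋ y≋ x≉y (λ _ → pair-vee i≢j p)
  M₄₅-only2And4 (inj₂ x∈V) (inj₁ y∈J) x≉y with V⁻ x∈V | J̃₂⁻ y∈J
  ... | p , x≋ | i , j , i≢j , y≋ = 2-or-4-resp-≋ x≋ y≋ x≉y
    (λ _ → Sum.map (trans d≈) (trans d≈) (pair-vee i≢j p))
    where d≈ = dist²-sym (vee p) (pair i j)
  M₄₅-only2And4 (inj₂ x∈V) (inj₂ y∈V) x≉y with V⁻ x∈V | V⁻ y∈V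
  ... | p , x≋ | q , y≋ = 2-or-4-resp-≋ x≋ y≋ x≉y (λ p≉q → inj₁ (vee-vee p q p≉q))

  J̃₂-realises-2 : ∀ {m} {i j k : Fin (2 ℕ.+ m)} → i ≢ j → i ≢ k → j ≢ k →
                  Realises (J̃₂ (2 ℕ.+ m)) 2#
  J̃₂-realises-2 {i = i} {j} {k} i≢j i≢k j≢k =
    pair i j , pair i k , J̃₂⁺ i≢j (λ _ → refl) , J̃₂⁺ i≢k (λ _ → refl) ,
    trans (dist²-pairs i≢j i≢k (pair-left i≢j) (pair-off i≢k j≢k)) 4-2*[1+0]≈2

  J̃₂-realises-4 : ∀ {m} {i j k l : Fin (2 ℕ.+ m)} → i ≢ j → k ≢ l →
                  i ≢ k → j ≢ k → i ≢ l → j ≢ l → Realises (J̃₂ (2 ℕ.+ m)) 4#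
  J̃₂-realises-4 {i = i} {j} {k} {l} i≢j k≢l i≢k j≢k i≢l j≢l =
    pair i j , pair k l , J̃₂⁺ i≢j (λ _ → refl) , J̃₂⁺ k≢l (λ _ → refl) ,
    trans (dist²-pairs i≢j k≢l (pair-off i≢k j≢k) (pair-off i≢l j≢l)) 4-2*[0+0]≈4

  realises-2 : ∀ {m} → Realises (J̃₂ (4 ℕ.+ m)) 2#
  realises-2 = J̃₂-realises-2 {i = 0F} {1F} {2F} (λ ()) (λ ()) (λ ())

  -- Disjoint pairs require four coordinates. For n = 3 any two pairs meet, and the squared distance
  -- 4 does not occur.
  realises-4 : ∀ {m} → Realises (J̃₂ (4 ℕ.+ m)) 4#
  realises-4 = J̃₂-realises-4 {i = 0F} {1F} {2F} {3F} (λ ()) (λ ()) (λ ()) (λ ()) (λ ()) (λ ())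

  0≤2 : 0# ≤ 2#
  0≤2 = 0≤×1 2

  0≤4 : 0# ≤ 4#
  0≤4 = 0≤×1 4

  open Roots (proj₁ (sqrt 0≤2)) (proj₁ (sqrt 0≤4))
             (proj₁ (proj₂ (sqrt 0≤2))) (proj₁ (proj₂ (sqrt 0≤4)))
             (proj₂ (proj₂ (sqrt 0≤2))) (proj₂ (proj₂ (sqrt 0≤4)))

  J̃₂-isDistanceSet : ∀ m → let n = 4 ℕ.+ m in IsDistanceSetIn 2 (H₂ n) (J̃₂ n)
  J̃₂-isDistanceSet m =
    J̃₂⊆H₂ ,
    HasSize⇒Finite {S = ≋-setoid _} (J̃₂-size (2 ℕ.+ m)) ,
    only2And4⇒twoDistances realises-2 realises-4 J̃₂-only2And4

  M₄₅-isDistanceSet : IsDistanceSetIn 2 (H₂ 9) M₄₅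
  M₄₅-isDistanceSet =
    [ J̃₂⊆H₂ , V⊆H₂ ]′ ,
    HasSize⇒Finite {S = ≋-setoid 9} M₄₅-size ,
    only2And4⇒twoDistances (Realises-mono {X = J̃₂ 9} inj₁ realises-2)
                           (Realises-mono {X = J̃₂ 9} inj₁ realises-4)
                           M₄₅-only2And4

  -- Classification of extensions and maximality

  -- A finite search decides whether y equals some pair. If not, y is distinct from every pair, so
  -- each squared distance to a pair is 2 or 4, which are the two alternatives of `pairSum`.
  extension-point : ∀ {m} (Y : PointSet (4 ℕ.+ m)) → IsDistanceSetIn 2 (H₂ _) Y → J̃₂ _ ⊆ Y →
                    ∀ y → y ∈ Y → y ∈ J̃₂ _ ⊎ (4 ℕ.+ m ≡ 9 × (∃[ p ] y ≋ spike ⅓ (- 1#) p))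
  extension-point Y (Y⊆H , _ , distances) J⊆Y y y∈Y
    with any? (λ i → any? (λ j → ¬? (i ≟ j) ×-dec all? (λ k → y k ≟ʳ pair i j k)))
  ... | yes (i , j , i≢j , y≋) = inj₁ (J̃₂⁺ i≢j y≋)
  ... | no y∉J = inj₂ (TwoPairSums.only-vee y ⟪ y , y ⟫ pairSum (Y⊆H y∈Y) refl)
    where
    only : Only2And4 Y
    only = twoDistances⇒only2And4 (Realises-mono J⊆Y realises-2)
                                  (Realises-mono J⊆Y realises-4) distances

    pairSum : ∀ {i j} → i ≢ j → 2# * (y i + y j) ≈ ⟪ y , y ⟫ ⊎ 2# * (y i + y j) + 2# ≈ ⟪ y , y ⟫
    pairSum {i} {j} i≢j = Sum.map
      (λ eq → combine (- 1#)
        (solve 2 (λ n s → s :- n := (:- con (+ 1)) :* ((n :+ con (+ 2) :- s) :- con (+ 2)))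
          refl ⟪ y , y ⟫ (2# * (y i + y j)))
        (trans (sym (dist²-pair y i≢j)) eq))
      (λ eq → combine (- 1#)
        (solve 2 (λ n s → (s :+ con (+ 2)) :- n
                       := (:- con (+ 1)) :* ((n :+ con (+ 2) :- s) :- con (+ 4)))
          refl ⟪ y , y ⟫ (2# * (y i + y j)))
        (trans (sym (dist²-pair y i≢j)) eq))
      (only y∈Y (J⊆Y (J̃₂⁺ i≢j (λ _ → refl))) (λ y≋ → y∉J (i , j , i≢j , y≋)))

  M₄₅-contains-extensions : (Y : PointSet 9) → IsDistanceSetIn 2 (H₂ 9) Y → J̃₂ 9 ⊆ Y → Y ⊆ M₄₅
  M₄₅-contains-extensions Y Y-dist J⊆Y {y} y∈Y =
    Sum.map₂ (λ (_ , p , y≋) → V⁺ {p = p} y≋) (extension-point Y Y-dist J⊆Y y y∈Y)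

  J̃₂-maximal : ∀ n → 4 ≤ⁿ n → n ≢ 9 → IsMaximalDistanceSetIn 2 (H₂ n) (J̃₂ n)
  J̃₂-maximal (suc (suc (suc (suc m)))) (s≤s (s≤s (s≤s (s≤s _)))) n≢9 =
    J̃₂-isDistanceSet m , λ Y Y-dist J⊆Y →
      (λ {y} y∈Y → [ id , ⊥-elim ∘ n≢9 ∘ proj₁ ]′ (extension-point Y Y-dist J⊆Y y y∈Y)) , J⊆Y

mainTheorem2 : (ℛ : Reals) → let open Euclidean ℛ in
    ((n : ℕ) → 4 ≤ⁿ n → n ≢ 9 → IsMaximalDistanceSetIn 2 (H₂ n) (J̃₂ n))
    × ( IsMaximalDistanceSetIn 2 (H₂ 9) M₄₅
    × J̃₂ 9 ⊆ M₄₅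
    × ((X : PointSet 9) → IsMaximalDistanceSetIn 2 (H₂ 9) X → J̃₂ 9 ⊆ X → X ≐ M₄₅)
    × HasPoints 45 M₄₅)
mainTheorem2 ℛ =
  J̃₂-maximal ,
  (M₄₅-isDistanceSet , λ Y Y-dist M₄₅⊆Y →
    M₄₅-contains-extensions Y Y-dist (M₄₅⊆Y ∘ inj₁) , M₄₅⊆Y) ,
  inj₁ ,
  (λ X (X-dist , X-maximal) J⊆X →
    let X⊆M₄₅ = M₄₅-contains-extensions X X-dist J⊆X
    -- `M₄₅` is itself a two-distance set and contains X, so the maximality of X yields the reverse
    -- inclusion.
    in X⊆M₄₅ , proj₁ (X-maximal M₄₅ M₄₅-isDistanceSet X⊆M₄₅)) ,
  M₄₅-size
  where
  open Euclidean ℛ using (M₄₅)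
  open JohnsonGraph ℛ
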